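{- The following hold: $\Sigma(\mathrm{NMAJ})\equiv_{\mathrm W}\Sigma(\mathrm{NGEQ})\equiv_{\mathrm W}\mathrm{DIS}$; $\Pi(\mathrm{NMAJ})\equiv_{\mathrm{sW}}\mathrm{HYP}$; $\mathrm{DIS}<_{\mathrm W}\mathrm{NMAJ}<_{\mathrm W}\mathrm{HYP}$; and $\mathrm{NON}<_{\mathrm W}\mathrm{HYP}^{\mathcal D}$. In particular, $\mathrm{NMAJ}$ is not stashable, i.e., $\mathrm{NMAJ}\not\equiv_{\mathrm W}\Sigma(\mathrm{NMAJ})$.
   Context: A represented space is a set $X$ with a partial surjective map $\delta_X:\subseteq\mathbb N^{\mathbb N}\to X$. A problem is a partial multi-valued function $f:\subseteq X\rightrightarrows Y$ between represented spaces that has a realizer; a realizer of $f$ is a function $F:\subseteq\mathbb N^{\mathbb N}\to\mathbb N^{\mathbb N}$ with $\delta_YF(p)\in f\delta_X(p)$ for all $p\in\mathrm{dom}(f\delta_X)$. For $p,q\in\mathbb N^{\mathbb N}$, $\langle p,q\rangle(2n)=p(n)$, $\langle p,q\rangle(2n+1)=q(n)$. For problems $f,g$: $f\leq_{\mathrm W}g$ if there are computable $H,K:\subseteq\mathbb N^{\mathbb N}\to\mathbb N^{\mathbb N}$ such that $H\langle\mathrm{id},GK\rangle$ is a realizer of $f$ whenever $G$ is a realizer of $g$; $f\leq_{\mathrm{sW}}g$ is defined likewise with $HGK$ instead of $H\langle\mathrm{id},GK\rangle$. $\equiv_{\mathrm W},\equiv_{\mathrm{sW}}$ are the induced equivalences;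 $f<_{\mathrm W}g$ means $f\leq_{\mathrm W}g$ and $g\not\leq_{\mathrm W}f$. For a represented space $Y$, the completion $\overline Y:=Y\cup\{\bot\}$ ($\bot\notin Y$) is represented by $\delta_{\overline Y}(p)=\delta_Y(p-1)$ if $p-1\in\mathrm{dom}(\delta_Y)$ and $\delta_{\overline Y}(p)=\bot$ otherwise, where $p-1\in\mathbb N^{\mathbb N}\cup\mathbb N^*$ is the concatenation of $p(0)-1,p(1)-1,\dots$ and $0-1$ is the empty word. $\mathbb N^{\mathbb N}$ is represented by the identity, $\mathbb N$ by $p\mapsto p(0)$, and $X^{\mathbb N}$ by $\langle p_0,p_1,\dots\rangle\mapsto(\delta_X(p_n))_n$, where $\langle p_0,p_1,\dots\rangle\langle n,k\rangle:=p_n(k)$ and $\langle n,k\rangle:=\frac12(n+k)(n+k+1)+k$ for $n,k\in\mathbb N$. For $f:\subseteq X\rightrightarrows Y$: $\Pi f:\subseteq X^{\mathbb N}\rightrightarrows Y^{\mathbb N}$ has domain $\mathrm{dom}(f)^{\mathbb N}$ and $\Pi f((x_n)_n)=\{(y_n)_n:(\forall n)\ y_n\in f(x_n)\}$; $\Sigma f:\subseteq X^{\mathbb N}\rightrightarrows\overline Y^{\mathbb N}$ has domain $\mathrm{dom}(f)^{\mathbb N}$ and $\Sigma f((x_n)_n)=\{(y_n)_n\in\overline Y^{\mathbb N}:(\exists n)\ y_n\in f(x_n)\}$. $\mathcal D$ is the set of Turing degrees, represented by $p\mapsto\deg_{\mathrm T}(p)$. For $y\in Y$ and $q\in\mathbb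 N^{\mathbb N}$, $y\leq_{\mathrm T}q$ means that some name of $y$ is Turing reducible to $q$. $f^{\mathcal D}:\subseteq X\rightrightarrows\mathcal D$ has $\mathrm{dom}(f^{\mathcal D})=\mathrm{dom}(f)$ and $f^{\mathcal D}(x)=\{\deg_{\mathrm T}(q):(\exists y\leq_{\mathrm T}q)\ y\in f(x)\}$. $\varphi^p$ is a standard Gödel numbering of the partial functions $\varphi_i^p:\subseteq\mathbb N\to\mathbb N$ computable relative to $p$; for $i\in\mathbb N$, $p\in\mathbb N^{\mathbb N}$, $\langle i,p\rangle:=ip$ (concatenation). The condition $\varphi_i^p(n)\not\geq k$ means that either $\varphi_i^p(n)$ is undefined, or it is defined and $\varphi_i^p(n)<k$. - $\mathrm{NGEQ}:\mathbb N^{\mathbb N}\rightrightarrows\mathbb N$, $\langle\langle i,n\rangle,p\rangle\mapsto\{k:\varphi_i^p(n)\not\geq k\}$. - $\mathrm{NMAJ}:\mathbb N^{\mathbb N}\rightrightarrows\mathbb N^{\mathbb N}$, $\langle i,p\rangle\mapsto\{q:(\exists n)\ \varphi_i^p(n)\not\geq q(n)\}$. - $\mathrm{HYP}:\mathbb N^{\mathbb N}\rightrightarrows\mathbb N^{\mathbb N}$, $p\mapsto\{q:(\forall r\in\mathbb N^{\mathbb N},\ r\leq_{\mathrm T}p)(\exists n)\ r(n)<q(n)\}$. - $\mathrm{NON}:\mathbb N^{\mathbb N}\rightrightarrows\mathbb N^{\mathbb N}$, $p\mapsto\{q:q\not\leq_{\mathrm T}p\}$. - $\mathrm{DIS}:\mathbb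 N^{\mathbb N}\rightrightarrows\mathbb N^{\mathbb N}$, $p\mapsto\{q:\mathrm U(p)\neq q\}$ (every $q$ is a solution if $\mathrm U(p)$ is undefined), where $\mathrm U\langle\langle i,r\rangle,p\rangle:=\varphi_i^{\langle r,p\rangle}$ if this function is total and undefined otherwise ($i\in\mathbb N$, $r,p\in\mathbb N^{\mathbb N}$). -}

module Defs where

open import Axiom.ExcludedMiddle public using (ExcludedMiddle)
open import Data.Fin.Base using (Fin; zero; suc)
open import Data.Maybe.Base using (Maybe; just; nothing)
open import Data.Maybe.Relation.Binary.Pointwise as MaybeP using (just; nothing)
open import Data.Nat.Base
open import Data.Nat.Divisibility using (divides)
open import Data.Nat.DivMod using (_/_; m*n/n≡m; +-distrib-/-∣ʳ)
open import Data.Nat.Properties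
open import Data.Nat.Tactic.RingSolver using (solve-∀)
open import Data.Product using (Σ; ∃; ∃₂; _×_; _,_; proj₁; proj₂)
open import Data.Sum.Base using (_⊎_; inj₁; inj₂)
open import Data.Vec.Base using (Vec; []; _∷_; lookup)
open import Function.Base using (_∘_)
open import Function.Bundles using (_⇔_)
open import Level using (0ℓ) public
open import Relation.Binary.Bundles using (Setoid)
open import Relation.Binary.Definitions using (tri<; tri≈; tri>)
open import Relation.Binary.PropositionalEquality
  using (_≡_; _≗_; refl; sym; trans; cong; subst; _→-setoid_; module ≡-Reasoning)
  renaming (setoid to ≡-setoid)
open import Relation.Nullary.Negation.Core using (¬_; contradiction)

Baire : Set
Baire = ℕ → ℕ

-- ⟪ p , q ⟫ interleaves: entry 2n is p n and entry 2n+1 is q n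
-- (see ⟪⟫-even and ⟪⟫-odd).
⟪_,_⟫ : Baire → Baire → Baire
⟪ p , q ⟫ zero    = p zero
⟪ p , q ⟫ (suc n) = ⟪ q , p ∘ suc ⟫ n

evens odds tail : Baire → Baire
evens p n = p (2 * n)
odds  p n = p (suc (2 * n))
tail  p n = p (suc n)

⟪⟫-even : ∀ p q → evens ⟪ p , q ⟫ ≗ p
⟪⟫-even p q zero = refl
⟪⟫-even p q (suc n) rewrite +-suc n (n + 0) = ⟪⟫-even (tail p) (tail q) n

⟪⟫-odd : ∀ p q → odds ⟪ p , q ⟫ ≗ q
⟪⟫-odd p q n = ⟪⟫-even q (tail p) n

⟪⟫-cong : ∀ {p p′ q q′} → p ≗ p′ → q ≗ q′ → ⟪ p , q ⟫ ≗ ⟪ p′ , q′ ⟫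
⟪⟫-cong e f zero    = e zero
⟪⟫-cong e f (suc n) = ⟪⟫-cong f (e ∘ suc) n

⟨_,_⟩ : ℕ → ℕ → ℕ
⟨ n , k ⟩ = ((n + k) * (n + k + 1)) / 2 + k

-- The pair following (n , k) on the Cantor diagonal walk.
next : ℕ × ℕ → ℕ × ℕ
next (zero  , k) = suc k , zero
next (suc n , k) = n , suc k

unpair : ℕ → ℕ × ℕ
unpair zero    = zero , zero
unpair (suc c) = next (unpair c)

triangle-suc : ∀ s → (suc s * (suc s + 1)) / 2 ≡ suc ((s * (s + 1)) / 2 + s)
triangle-suc s = begin
  (suc s * (suc s + 1)) / 2              ≡⟨ cong (_/ 2) (expand s) ⟩
  (s * (s + 1) + suc s * 2) / 2          ≡⟨ +-distrib-/-∣ʳ (s * (s + 1)) (divides (suc s) refl) ⟩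
  (s * (s + 1)) / 2 + (suc s * 2) / 2    ≡⟨ cong ((s * (s + 1)) / 2 +_) (m*n/n≡m (suc s) 2) ⟩
  (s * (s + 1)) / 2 + suc s              ≡⟨ +-suc _ s ⟩
  suc ((s * (s + 1)) / 2 + s)            ∎
  where
  open ≡-Reasoning
  expand : ∀ t → suc t * (suc t + 1) ≡ t * (t + 1) + suc t * 2
  expand = solve-∀

pair-next : ∀ n k → ⟨ proj₁ (next (n , k)) , proj₂ (next (n , k)) ⟩ ≡ suc ⟨ n , k ⟩
pair-next zero k rewrite +-identityʳ k =
  trans (+-identityʳ _) (triangle-suc k)
pair-next (suc n) k rewrite +-suc n k = +-suc _ k

unpair-pair : ∀ n k → unpair ⟨ n , k ⟩ ≡ (n , k)
unpair-pair n k = go (n + k) n k refl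
  where
  go : ∀ s n k → n + k ≡ s → unpair ⟨ n , k ⟩ ≡ (n , k)
  go s n (suc k) e =
    trans (cong unpair (pair-next (suc n) k))
          (cong next (go s (suc n) k (trans (sym (+-suc n k)) e)))
  go s zero zero e = refl
  go (suc s) (suc n) zero e =
    trans (cong unpair (pair-next zero n))
          (cong next (go s zero n (trans (sym (+-identityʳ n)) (suc-injective e))))

-- Computability relative to an oracle: Kleene's partial recursive
-- functions with the oracle as an additional initial function.
data Code : ℕ → Set where
  zeroᶜ  : Code 0
  sucᶜ   : Code 1
  oracle : Code 1
  proj   : ∀ {n} → Fin n → Code n
  comp   : ∀ {m n} → Code m → Vec (Code n) m → Code n
  prec   : ∀ {n} → Code n → Code (2 + n) → Code (1 + n)
  μ      : ∀ {n} → Code (1 + n) → Code n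

infix 4 _⊢_·_⇓_ _⊢_·*_⇓_

mutual
  data _⊢_·_⇓_ (p : Baire) : ∀ {n} → Code n → Vec ℕ n → ℕ → Set where
    ⇓zero : p ⊢ zeroᶜ · [] ⇓ 0
    ⇓suc  : ∀ {x} → p ⊢ sucᶜ · (x ∷ []) ⇓ suc x
    ⇓oracle : ∀ {x} → p ⊢ oracle · (x ∷ []) ⇓ p x
    ⇓proj : ∀ {n} {i : Fin n} {xs} → p ⊢ proj i · xs ⇓ lookup xs i
    ⇓comp : ∀ {m n} {f : Code m} {gs : Vec (Code n) m} {xs ys z} →
            p ⊢ gs ·* xs ⇓ ys → p ⊢ f · ys ⇓ z → p ⊢ comp f gs · xs ⇓ z
    ⇓prec-zero : ∀ {n} {f : Code n} {g xs z} →
                 p ⊢ f · xs ⇓ z → p ⊢ prec f g · (0 ∷ xs) ⇓ z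
    ⇓prec-suc : ∀ {n} {f : Code n} {g x xs y z} →
                p ⊢ prec f g · (x ∷ xs) ⇓ y → p ⊢ g · (x ∷ y ∷ xs) ⇓ z →
                p ⊢ prec f g · (suc x ∷ xs) ⇓ z
    ⇓μ : ∀ {n} {f : Code (1 + n)} {xs x} (ys : ℕ → ℕ) →
         (∀ {k} → k < x → p ⊢ f · (k ∷ xs) ⇓ suc (ys k)) →
         p ⊢ f · (x ∷ xs) ⇓ 0 → p ⊢ μ f · xs ⇓ x

  data _⊢_·*_⇓_ (p : Baire) {n} : ∀ {m} → Vec (Code n) m → Vec ℕ n → Vec ℕ m → Set where
    ⇓[] : ∀ {xs} → p ⊢ [] ·* xs ⇓ []
    ⇓∷  : ∀ {m} {g} {gs : Vec (Code n) m} {xs y ys} →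
          p ⊢ g · xs ⇓ y → p ⊢ gs ·* xs ⇓ ys → p ⊢ (g ∷ gs) ·* xs ⇓ (y ∷ ys)

-- p computes q by means of the program c.
_⊢_↦_ : Baire → Code 1 → Baire → Set
p ⊢ c ↦ q = ∀ n → p ⊢ c · (n ∷ []) ⇓ q n

infix 4 _⊢_↦_ _≤T_ _≡T_

_≤T_ : Baire → Baire → Set
q ≤T p = ∃ λ c → p ⊢ c ↦ q

_≡T_ : Baire → Baire → Set
p ≡T q = p ≤T q × q ≤T p

mutual
  substᶜ : ∀ {n} → Code 1 → Code n → Code n
  substᶜ d zeroᶜ       = zeroᶜ
  substᶜ d sucᶜ        = sucᶜ
  substᶜ d oracle      = d
  substᶜ d (proj i)    = proj i
  substᶜ d (comp f gs) = comp (substᶜ d f) (substᶜ* d gs)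
  substᶜ d (prec f g)  = prec (substᶜ d f) (substᶜ d g)
  substᶜ d (μ f)       = μ (substᶜ d f)

  substᶜ* : ∀ {m n} → Code 1 → Vec (Code n) m → Vec (Code n) m
  substᶜ* d []       = []
  substᶜ* d (g ∷ gs) = substᶜ d g ∷ substᶜ* d gs

mutual
  substᶜ-⇓ : ∀ {p q d n} {c : Code n} {xs z} →
             p ⊢ d ↦ q → q ⊢ c · xs ⇓ z → p ⊢ substᶜ d c · xs ⇓ z
  substᶜ-⇓ h ⇓zero           = ⇓zero
  substᶜ-⇓ h ⇓suc            = ⇓suc
  substᶜ-⇓ h ⇓oracle         = h _
  substᶜ-⇓ h ⇓proj           = ⇓proj
  substᶜ-⇓ h (⇓comp es e)    = ⇓comp (substᶜ*-⇓ h es) (substᶜ-⇓ h e)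
  substᶜ-⇓ h (⇓prec-zero e)  = ⇓prec-zero (substᶜ-⇓ h e)
  substᶜ-⇓ h (⇓prec-suc e f) = ⇓prec-suc (substᶜ-⇓ h e) (substᶜ-⇓ h f)
  substᶜ-⇓ h (⇓μ ys es e)    = ⇓μ ys (λ lt → substᶜ-⇓ h (es lt)) (substᶜ-⇓ h e)

  substᶜ*-⇓ : ∀ {p q d m n} {gs : Vec (Code n) m} {xs ys} →
              p ⊢ d ↦ q → q ⊢ gs ·* xs ⇓ ys → p ⊢ substᶜ* d gs ·* xs ⇓ ys
  substᶜ*-⇓ h ⇓[]       = ⇓[]
  substᶜ*-⇓ h (⇓∷ e es) = ⇓∷ (substᶜ-⇓ h e) (substᶜ*-⇓ h es)

mutual
  ⇓-resp : ∀ {p q n} {c : Code n} {xs z} →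
           p ≗ q → p ⊢ c · xs ⇓ z → q ⊢ c · xs ⇓ z
  ⇓-resp h ⇓zero           = ⇓zero
  ⇓-resp h ⇓suc            = ⇓suc
  ⇓-resp {q = q} h (⇓oracle {x}) =
    subst (q ⊢ oracle · (x ∷ []) ⇓_) (sym (h x)) ⇓oracle
  ⇓-resp h ⇓proj           = ⇓proj
  ⇓-resp h (⇓comp es e)    = ⇓comp (⇓*-resp h es) (⇓-resp h e)
  ⇓-resp h (⇓prec-zero e)  = ⇓prec-zero (⇓-resp h e)
  ⇓-resp h (⇓prec-suc e f) = ⇓prec-suc (⇓-resp h e) (⇓-resp h f)
  ⇓-resp h (⇓μ ys es e)    = ⇓μ ys (λ lt → ⇓-resp h (es lt)) (⇓-resp h e)

  ⇓*-resp : ∀ {p q m n} {gs : Vec (Code n) m} {xs ys} →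
            p ≗ q → p ⊢ gs ·* xs ⇓ ys → q ⊢ gs ·* xs ⇓ ys
  ⇓*-resp h ⇓[]       = ⇓[]
  ⇓*-resp h (⇓∷ e es) = ⇓∷ (⇓-resp h e) (⇓*-resp h es)

≤T-reflexive : ∀ {p q} → p ≗ q → p ≤T q
≤T-reflexive {q = q} h =
  oracle , λ n → subst (q ⊢ oracle · (n ∷ []) ⇓_) (sym (h n)) ⇓oracle

≤T-trans : ∀ {p q r} → p ≤T q → q ≤T r → p ≤T r
≤T-trans (c , e) (d , f) = substᶜ d c , λ n → substᶜ-⇓ f (e n)

≡T-sym : ∀ {p q} → p ≡T q → q ≡T p
≡T-sym (a , b) = b , a

≡T-trans : ∀ {p q r} → p ≡T q → q ≡T r → p ≡T r
≡T-trans (a , b) (c , d) = ≤T-trans a c , ≤T-trans d b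

≡T-reflexive : ∀ {p q} → p ≗ q → p ≡T q
≡T-reflexive h = ≤T-reflexive h , ≤T-reflexive (sym ∘ h)

ComputableSeq : Baire → Set
ComputableSeq s = s ≤T (λ _ → 0)

-- A standard (acceptable) Gödel numbering of the functions that are partial
-- computable relative to an oracle, uniformly in the oracle: it has a
-- universal program (utm), and every uniformly computable sequence of partial
-- functions translates computably into it (smn).  Taking a program that
-- ignores its first argument in smn shows that all of them are enumerated.
record GödelNumbering : Set where
  field
    universal : Code 2

  φ[_,_]_⇓_ : ℕ → Baire → ℕ → ℕ → Set
  φ[ i , p ] n ⇓ m = p ⊢ universal · (i ∷ n ∷ []) ⇓ m

  field
    smn : (c : Code 2) → ∃ λ s → ComputableSeq s ×
          (∀ i p n m → (φ[ s i , p ] n ⇓ m) ⇔ (p ⊢ c · (i ∷ n ∷ []) ⇓ m))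

  φ[_,_]_≱_ : ℕ → Baire → ℕ → ℕ → Set
  φ[ i , p ] n ≱ k = ¬ (∃ λ m → φ[ i , p ] n ⇓ m)
                   ⊎ (∃ λ m → (φ[ i , p ] n ⇓ m) × m < k)

  ≱-resp : ∀ {i j p q n k l} → i ≡ j → p ≗ q → k ≡ l →
           φ[ i , p ] n ≱ k → φ[ j , q ] n ≱ l
  ≱-resp refl h refl (inj₁ u) = inj₁ λ (m , e) → u (m , ⇓-resp (sym ∘ h) e)
  ≱-resp refl h refl (inj₂ (m , e , lt)) = inj₂ (m , ⇓-resp h e , lt)

-- A partial function on Baire space, as an extensional single-valued graph;
-- Agda functions would be total and could fail to respect _≗_.
record Baire⇀Baire : Set₁ where
  field
    graph      : Baire → Baire → Set
    resp       : ∀ {p p′ q q′} → p ≗ p′ → q ≗ q′ → graph p q → graph p′ q′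
    functional : ∀ {p q q′} → graph p q → graph p q′ → q ≗ q′

open Baire⇀Baire using () renaming (graph to _⟦_↦_⟧) public

-- F need not be defined on the whole natural domain of the program.
Computable : Baire⇀Baire → Set
Computable F = ∃ λ c → ∀ p q → F ⟦ p ↦ q ⟧ → p ⊢ c ↦ q

infixr 9 _∘ᵖ_

_∘ᵖ_ : Baire⇀Baire → Baire⇀Baire → Baire⇀Baire
G ∘ᵖ F = record
  { graph      = λ p r → ∃ λ q → F.graph p q × G.graph q r
  ; resp       = λ e f (q , a , b) →
                   q , F.resp e (λ _ → refl) a , G.resp (λ _ → refl) f b
  ; functional = λ (q , a , b) (q′ , a′ , b′) →
                   G.functional (G.resp (F.functional a a′) (λ _ → refl) b) b′
  }
  where
  module F = Baire⇀Baire F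
  module G = Baire⇀Baire G

⟨id,_⟩ : Baire⇀Baire → Baire⇀Baire
⟨id, F ⟩ = record
  { graph      = λ p r → ∃ λ q → F.graph p q × r ≗ ⟪ p , q ⟫
  ; resp       = λ e f (q , a , b) →
                   q , F.resp e (λ _ → refl) a ,
                   λ n → trans (sym (f n)) (trans (b n) (⟪⟫-cong e (λ _ → refl) n))
  ; functional = λ (q , a , b) (q′ , a′ , b′) n →
                   trans (b n) (trans (⟪⟫-cong (λ _ → refl) (F.functional a a′) n)
                                      (sym (b′ n)))
  }
  where module F = Baire⇀Baire F

-- δ is the graph of the partial surjection from Baire space.
record RepresentedSpace : Set₁ where
  field
    setoid : Setoid 0ℓ 0ℓ
  open Setoid setoid public using (Carrier; _≈_)
  field
    δ          : Baire → Carrier → Set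
    δ-resp     : ∀ {p q x y} → p ≗ q → x ≈ y → δ p x → δ q y
    functional : ∀ {p x y} → δ p x → δ p y → x ≈ y
    surjective : ∀ x → ∃ λ p → δ p x
  module Eq = Setoid setoid

open RepresentedSpace using (Carrier)

ℕᴿ : RepresentedSpace
ℕᴿ = record
  { setoid     = ≡-setoid ℕ
  ; δ          = λ p n → p 0 ≡ n
  ; δ-resp     = λ h e d → trans (sym (h 0)) (trans d e)
  ; functional = λ d e → trans (sym d) e
  ; surjective = λ n → (λ _ → n) , refl
  }

ℕ^ℕ : RepresentedSpace
ℕ^ℕ = record
  { setoid     = ℕ →-setoid ℕ
  ; δ          = _≗_
  ; δ-resp     = λ h e d n → trans (sym (h n)) (trans (d n) (e n))
  ; functional = λ d e n → trans (sym (d n)) (e n)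
  ; surjective = λ p → p , λ _ → refl
  }

-- Turing degrees: the carrier consists of representatives of degrees.
𝒟 : RepresentedSpace
𝒟 = record
  { setoid = record
    { Carrier = Baire
    ; _≈_     = _≡T_
    ; isEquivalence = record
      { refl  = ≡T-reflexive λ _ → refl
      ; sym   = ≡T-sym
      ; trans = ≡T-trans
      }
    }
  ; δ          = _≡T_
  ; δ-resp     = λ h e d → ≡T-trans (≡T-reflexive (sym ∘ h)) (≡T-trans d e)
  ; functional = λ d e → ≡T-trans (≡T-sym d) e
  ; surjective = λ p → p , ≡T-reflexive λ _ → refl
  }

_^ℕ : RepresentedSpace → RepresentedSpace
X ^ℕ = record
  { setoid = record
    { Carrier = ℕ → X.Carrier
    ; _≈_     = λ xs ys → ∀ n → xs n X.≈ ys n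
    ; isEquivalence = record
      { refl  = λ _ → X.Eq.refl
      ; sym   = λ e n → X.Eq.sym (e n)
      ; trans = λ e f n → X.Eq.trans (e n) (f n)
      }
    }
  ; δ          = λ p xs → ∀ n → X.δ (λ k → p ⟨ n , k ⟩) (xs n)
  ; δ-resp     = λ h e d n → X.δ-resp (λ k → h ⟨ n , k ⟩) (e n) (d n)
  ; functional = λ d e n → X.functional (d n) (e n)
  ; surjective = λ xs →
      let name = λ n → proj₁ (X.surjective (xs n)) in
      (λ c → name (proj₁ (unpair c)) (proj₂ (unpair c))) ,
      λ n → X.δ-resp
        (λ k → cong (λ c → name (proj₁ c) (proj₂ c)) (sym (unpair-pair n k)))
        X.Eq.refl (proj₂ (X.surjective (xs n)))
  }
  where module X = RepresentedSpace X

-- The length of the concatenation of p(0)-1, …, p(k-1)-1, where 0-1 is empty.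
length-1 : Baire → ℕ → ℕ
length-1 p zero = 0
length-1 p (suc k) with p k
... | zero  = length-1 p k
... | suc _ = suc (length-1 p k)

-- p-1 is infinite and equal to q: the letter at position n is contributed
-- by the p(k) ≠ 0 that is preceded by exactly n nonzero entries.
_-1≡_ : Baire → Baire → Set
p -1≡ q = ∀ n → ∃ λ k → length-1 p k ≡ n × p k ≡ suc (q n)

length-1-suc : ∀ p k {m} → p k ≡ suc m → length-1 p (suc k) ≡ suc (length-1 p k)
length-1-suc p k e with p k
length-1-suc p k refl | suc _ = refl

length-1-step : ∀ p k → length-1 p k ≤ length-1 p (suc k)
length-1-step p k with p k
... | zero  = ≤-refl
... | suc _ = n≤1+n _

length-1-mono : ∀ p {k l} → k ≤′ l → length-1 p k ≤ length-1 p l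
length-1-mono p ≤′-refl = ≤-refl
length-1-mono p {l = suc l} (≤′-step le) =
  ≤-trans (length-1-mono p le) (length-1-step p l)

length-1-< : ∀ p {k l m} → p k ≡ suc m → k < l → length-1 p k < length-1 p l
length-1-< p {k} e lt =
  subst (_≤ _) (length-1-suc p k e) (length-1-mono p (≤⇒≤′ lt))

length-1-cong : ∀ {p q} → p ≗ q → length-1 p ≗ length-1 q
length-1-cong h zero = refl
length-1-cong {p} {q} h (suc k) with p k | q k | h k
... | zero  | .zero    | refl = length-1-cong h k
... | suc m | .(suc m) | refl = cong suc (length-1-cong h k)

length-1-full : ∀ q k → length-1 (suc ∘ q) k ≡ k
length-1-full q zero    = refl
length-1-full q (suc k) = cong suc (length-1-full q k)

-1-functional : ∀ {p q r} → p -1≡ q → p -1≡ r → q ≗ r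
-1-functional {p} a b n with a n | b n
... | k , e , f | l , e′ , f′ with <-cmp k l
... | tri< lt _ _ = contradiction (trans e (sym e′)) (<⇒≢ (length-1-< p f lt))
... | tri≈ _ refl _ = suc-injective (trans (sym f) f′)
... | tri> _ _ gt = contradiction (trans e′ (sym e)) (<⇒≢ (length-1-< p f′ gt))

-1-resp : ∀ {p p′ q} → p ≗ p′ → p -1≡ q → p′ -1≡ q
-1-resp h a n with a n
... | k , e , f = k , trans (sym (length-1-cong h k)) e , trans (sym (h k)) f

-- nothing is the additional point ⊥.
Completion : RepresentedSpace → RepresentedSpace
Completion X = record
  { setoid     = MaybeP.setoid X.setoid
  ; δ          = δ̄
  ; δ-resp     = δ̄-resp
  ; functional = δ̄-functional
  ; surjective = λ where
      (just x) → let p , d = X.surjective x in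
        suc ∘ p , p , (λ n → n , length-1-full p n , refl) , d
      nothing  → (λ _ → 0) , λ (q , e , _) → contradiction (proj₂ (proj₂ (e 0))) λ ()
  }
  where
  module X = RepresentedSpace X

  δ̄ : Baire → Maybe X.Carrier → Set
  δ̄ p (just x) = ∃ λ q → p -1≡ q × X.δ q x
  δ̄ p nothing  = ¬ (∃ λ q → p -1≡ q × ∃ λ x → X.δ q x)

  δ̄-resp : ∀ {p q x y} → p ≗ q → MaybeP.Pointwise X._≈_ x y → δ̄ p x → δ̄ q y
  δ̄-resp h (just e) (r , m , d) = r , -1-resp h m , X.δ-resp (λ _ → refl) e d
  δ̄-resp h nothing u (r , m , d) = u (r , -1-resp (sym ∘ h) m , d)

  δ̄-functional : ∀ {p x y} → δ̄ p x → δ̄ p y → MaybeP.Pointwise X._≈_ x y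
  δ̄-functional {x = just x} {just y} (q , m , d) (q′ , m′ , d′) =
    just (X.functional (X.δ-resp (-1-functional m m′) X.Eq.refl d) d′)
  δ̄-functional {x = just x} {nothing} (q , m , d) u = contradiction (q , m , x , d) u
  δ̄-functional {x = nothing} {just y} u (q , m , d) = contradiction (q , m , y , d) u
  δ̄-functional {x = nothing} {nothing} _ _ = nothing

-- A partial multi-valued function is its graph, and its domain consists of
-- the points that have a value.
infix 3 _⇉_

record _⇉_ (X Y : RepresentedSpace) : Set₁ where
  private
    module X = RepresentedSpace X
    module Y = RepresentedSpace Y
  field
    _∋_↦_ : X.Carrier → Y.Carrier → Set
    resp  : ∀ {x x′ y y′} → x X.≈ x′ → y Y.≈ y′ → _∋_↦_ x y → _∋_↦_ x′ y′

  dom : X.Carrier → Set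
  dom x = ∃ λ y → _∋_↦_ x y

open _⇉_ using (_∋_↦_; dom) public

Realizes : ∀ {X Y} → Baire⇀Baire → X ⇉ Y → Set
Realizes {X} {Y} F f =
  ∀ p x → X.δ p x → dom f x →
  ∃ λ q → F ⟦ p ↦ q ⟧ × ∃ λ y → Y.δ q y × f ∋ x ↦ y
  where
  module X = RepresentedSpace X
  module Y = RepresentedSpace Y

module _ {X Y V W : RepresentedSpace} where

  infix 4 _≤W_ _≤sW_

  _≤W_ : X ⇉ Y → V ⇉ W → Set₁
  f ≤W g = ∃₂ λ H K → Computable H × Computable K ×
           (∀ G → Realizes G g → Realizes (H ∘ᵖ ⟨id, G ∘ᵖ K ⟩) f)

  _≤sW_ : X ⇉ Y → V ⇉ W → Set₁
  f ≤sW g = ∃₂ λ H K → Computable H × Computable K ×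
            (∀ G → Realizes G g → Realizes (H ∘ᵖ G ∘ᵖ K) f)

module _ {X Y V W : RepresentedSpace} where

  infix 4 _≡W_ _≡sW_ _<W_

  _≡W_ : X ⇉ Y → V ⇉ W → Set₁
  f ≡W g = f ≤W g × g ≤W f

  _≡sW_ : X ⇉ Y → V ⇉ W → Set₁
  f ≡sW g = f ≤sW g × g ≤sW f

  _<W_ : X ⇉ Y → V ⇉ W → Set₁
  f <W g = f ≤W g × ¬ (g ≤W f)

module _ {X Y : RepresentedSpace} where
  private
    module X = RepresentedSpace X
    module Y = RepresentedSpace Y

  Πᵂ : X ⇉ Y → X ^ℕ ⇉ Y ^ℕ
  Πᵂ f = record
    { _∋_↦_ = λ xs ys → ∀ n → f ∋ xs n ↦ ys n
    ; resp  = λ e e′ h n → _⇉_.resp f (e n) (e′ n) (h n)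
    }

  Σᵂ : X ⇉ Y → X ^ℕ ⇉ Completion Y ^ℕ
  Σᵂ f = record
    { _∋_↦_ = λ xs ys → (∀ n → dom f (xs n)) ×
                        (∃ λ n → ∃ λ y → ys n Ȳ.≈ just y × f ∋ xs n ↦ y)
    ; resp  = λ { e e′ (d , n , y , a , h) →
                  (λ m → proj₁ (d m) , _⇉_.resp f (e m) Y.Eq.refl (proj₂ (d m))) ,
                  n , y , Ȳ.Eq.trans (Ȳ.Eq.sym (e′ n)) a ,
                  _⇉_.resp f (e n) Y.Eq.refl h }
    }
    where module Ȳ = RepresentedSpace (Completion Y)

  -- Some name of the point y is Turing reducible to q.
  _≤ᵀ_ : Y.Carrier → Baire → Set
  y ≤ᵀ q = ∃ λ p → Y.δ p y × p ≤T q

  infix 20 _^𝒟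

  _^𝒟 : X ⇉ Y → X ⇉ 𝒟
  f ^𝒟 = record
    { _∋_↦_ = λ x d → ∃ λ q → d ≡T q × ∃ λ y → (y ≤ᵀ q) × f ∋ x ↦ y
    ; resp  = λ e e′ (q , a , y , b , h) →
                q , ≡T-trans (≡T-sym e′) a , y , b , _⇉_.resp f e Y.Eq.refl h
    }

HYP : ℕ^ℕ ⇉ ℕ^ℕ
HYP = record
  { _∋_↦_ = λ p q → ∀ r → r ≤T p → ∃ λ n → r n < q n
  ; resp  = λ e f h r le →
      let n , lt = h r (≤T-trans le (≤T-reflexive (sym ∘ e))) in
      n , subst (r n <_) (f n) lt
  }

NON : ℕ^ℕ ⇉ ℕ^ℕ
NON = record
  { _∋_↦_ = λ p q → ¬ (q ≤T p)
  ; resp  = λ e f h le →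
      h (≤T-trans (≤T-reflexive f) (≤T-trans le (≤T-reflexive (sym ∘ e))))
  }

module _ (𝒢 : GödelNumbering) where
  open GödelNumbering 𝒢

  NGEQ : ℕ^ℕ ⇉ ℕᴿ
  NGEQ = record
    { _∋_↦_ = λ x k → ∃₂ λ i n → x 0 ≡ ⟨ i , n ⟩ × φ[ i , tail x ] n ≱ k
    ; resp  = λ e f (i , n , a , h) →
        i , n , trans (sym (e 0)) a , ≱-resp refl (e ∘ suc) f h
    }

  NMAJ : ℕ^ℕ ⇉ ℕ^ℕ
  NMAJ = record
    { _∋_↦_ = λ x q → ∃ λ n → φ[ x 0 , tail x ] n ≱ q n
    ; resp  = λ e f (n , h) → n , ≱-resp (e 0) (e ∘ suc) (f n) h
    }

  -- U is defined on x with value q, where x = ⟪ ir , p ⟫.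
  U[_]⇓_ : Baire → Baire → Set
  U[ x ]⇓ q = ∀ n → φ[ i , ⟪ r , p ⟫ ] n ⇓ q n
    where
    i = evens x 0
    r = tail (evens x)
    p = odds x

  U-resp : ∀ {x y q q′} → x ≗ y → q ≗ q′ → U[ x ]⇓ q → U[ y ]⇓ q′
  U-resp {x} {y} e f h n rewrite sym (f n) | sym (e 0) =
    ⇓-resp (⟪⟫-cong (λ k → e (2 * suc k)) (λ k → e (suc (2 * k)))) (h n)

  DIS : ℕ^ℕ ⇉ ℕ^ℕ
  DIS = record
    { _∋_↦_ = λ x q → ¬ (U[ x ]⇓ q)
    ; resp  = λ e f h u → h (U-resp (sym ∘ e) (sym ∘ f) u)
    }

{-# OPTIONS --safe #-}

-- An answer q to DIS is wrong only if it equals the computable function f built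
-- from the query, so it suffices to let f recover q whenever all answers
-- extracted from q are wrong.  For Σ(NGEQ) ≤ DIS, instance ⟨a,b⟩ is answered by
-- 0 if q(a) = b, and otherwise by a bound for its value once that is known; if
-- all this fails, then q(a) is the only b such that instance ⟨a,b⟩ is defined.
-- For DIS ≤ Σ(NMAJ), q lists the letters of the answers, and the m-th
-- instance of NMAJ reads the letters of the m-th answer off f.
--
-- NMAJ ≰ DIS: U takes at most one of the values 000… and 111… on the query.  By
-- the recursion theorem there is an instance of NMAJ whose function waits until
-- both of these answers to DIS have been evaluated, or U has excluded one of
-- them, and then exceeds the results; it majorizes an admissible solution.
--
-- HYP ≰ NMAJ: computable instances of NMAJ have computable solutions, but those
-- of HYP do not.  HYP^𝒟 ≰ NON: some noncomputable function computes only
-- functions with a computable majorant.  It is obtained by forcing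
-- with Π⁰₁ classes in Cantor space: one forces φ_k^f(n) to be undefined for
-- some n if possible, and otherwise compactness bounds φ_k^f computably.

module Submission where

open import Defs
open import Data.Fin.Base using (Fin; zero; suc)
open import Data.Nat.Base hiding (parity)
open import Data.Nat.Properties
open import Data.Empty using (⊥)
open import Data.List.Base using (List; []; _∷_)
open import Data.Maybe.Base using (just; nothing)
open import Data.Product using (∃; ∃₂; _×_; _,_; proj₁; proj₂)
open import Data.Sum.Base using (_⊎_; inj₁; inj₂)
open import Data.Vec.Base using (Vec; []; _∷_; head; lookup; map; tabulate)
  renaming (tail to tailᵛ)
open import Data.Vec.Properties using (tabulate∘lookup)
open import Function.Base using (_∘_; _$_; id; case_of_)
open import Function.Bundles using (_⇔_; mk⇔; module Equivalence)
open import Relation.Binary.Definitions using (tri<; tri≈; tri>)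
open import Relation.Binary.PropositionalEquality
  using (_≡_; _≢_; _≗_; refl; sym; trans; cong; cong₂; subst; subst₂)
open import Relation.Nullary.Decidable.Core using (Dec; yes; no; decidable-stable)
open import Relation.Nullary.Negation.Core using (¬_; contradiction)

-- Determinism of relative computation

mutual
  ⇓-deterministic : ∀ {p n} {c : Code n} {xs y z} →
                    p ⊢ c · xs ⇓ y → p ⊢ c · xs ⇓ z → y ≡ z
  ⇓-deterministic ⇓zero ⇓zero = refl
  ⇓-deterministic ⇓suc ⇓suc = refl
  ⇓-deterministic ⇓oracle ⇓oracle = refl
  ⇓-deterministic ⇓proj ⇓proj = refl
  ⇓-deterministic (⇓comp es e) (⇓comp es′ e′) with ⇓*-deterministic es es′
  ... | refl = ⇓-deterministic e e′
  ⇓-deterministic (⇓prec-zero e) (⇓prec-zero e′) = ⇓-deterministic e e′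
  ⇓-deterministic (⇓prec-suc e f) (⇓prec-suc e′ f′) with ⇓-deterministic e e′
  ... | refl = ⇓-deterministic f f′
  ⇓-deterministic (⇓μ {x = x} ys es e) (⇓μ {x = x′} ys′ es′ e′) with <-cmp x x′
  ... | tri< lt _ _ = contradiction (⇓-deterministic e (es′ lt)) λ ()
  ... | tri≈ _ eq _ = eq
  ... | tri> _ _ gt = contradiction (⇓-deterministic e′ (es gt)) λ ()

  ⇓*-deterministic : ∀ {p m n} {gs : Vec (Code n) m} {xs ys zs} →
                     p ⊢ gs ·* xs ⇓ ys → p ⊢ gs ·* xs ⇓ zs → ys ≡ zs
  ⇓*-deterministic ⇓[] ⇓[] = refl
  ⇓*-deterministic (⇓∷ e es) (⇓∷ e′ es′) =
    cong₂ _∷_ (⇓-deterministic e e′) (⇓*-deterministic es es′)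

-- Total functionals computed uniformly in the oracle

Functional : ℕ → Set
Functional n = Baire → Vec ℕ n → ℕ

infixr 4 _,_

record Total {n : ℕ} (F : Functional n) : Set where
  constructor _,_
  field
    code     : Code n
    computes : ∀ p v → p ⊢ code · v ⇓ F p v

record Total* {m n : ℕ} (F : Baire → Vec ℕ n → Vec ℕ m) : Set where
  constructor _,_
  field
    codes    : Vec (Code n) m
    computes : ∀ p v → p ⊢ codes ·* v ⇓ F p v

open Total using (code; computes)

-- Wrapping in a record makes `f` recoverable by unification, so that `app₁` and its analogues need
-- no explicit function argument.
record Total₁ (f : ℕ → ℕ) : Set where
  constructor total₁
  field unwrap : Total {1} λ _ v → f (head v)

record Total₂ (f : ℕ → ℕ → ℕ) : Set where
  constructor total₂
  field unwrap : Total {2} λ _ v → f (head v) (head (tailᵛ v))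

record Total₃ (f : ℕ → ℕ → ℕ → ℕ) : Set where
  constructor total₃
  field unwrap : Total {3} λ _ v → f (head v) (head (tailᵛ v)) (head (tailᵛ (tailᵛ v)))

total-resp : ∀ {n} {F G : Functional n} → (∀ p v → F p v ≡ G p v) → Total F → Total G
total-resp e (c , h) = c , λ p v → subst (p ⊢ c · v ⇓_) (e p v) (h p v)

-- Extensionality in the oracle comes from the program: the same evaluation is valid under both
-- oracles, and its result is unique.
total-cong : ∀ {n} {F : Functional n} → Total F → ∀ {p q} v → p ≗ q → F p v ≡ F q v
total-cong (c , h) v e = ⇓-deterministic (⇓-resp e (h _ v)) (h _ v)

varᵗ : ∀ {n} (i : Fin n) → Total λ _ v → lookup v i
varᵗ i = proj i , λ _ _ → ⇓proj

infixr 5 _∷ᵗ_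

[]ᵗ : ∀ {n} → Total* {0} {n} λ _ _ → []
[]ᵗ = [] , λ _ _ → ⇓[]

_∷ᵗ_ : ∀ {m n} {F : Functional n} {G : Baire → Vec ℕ n → Vec ℕ m} →
       Total F → Total* G → Total* λ p v → F p v ∷ G p v
(c , h) ∷ᵗ (cs , hs) = c ∷ cs , λ p v → ⇓∷ (h p v) (hs p v)

appᵗ : ∀ {m n} {F : Functional m} {G : Baire → Vec ℕ n → Vec ℕ m} →
       Total F → Total* G → Total λ p v → F p (G p v)
appᵗ (c , h) (cs , hs) = comp c cs , λ p v → ⇓comp (hs p v) (h p _)

total*-resp : ∀ {m n} {F G : Baire → Vec ℕ n → Vec ℕ m} →
              (∀ p v → F p v ≡ G p v) → Total* F → Total* G
total*-resp e (cs , h) = cs , λ p v → subst (p ⊢ cs ·* v ⇓_) (e p v) (h p v)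

app*ᵗ : ∀ {l m n} {F : Baire → Vec ℕ m → Vec ℕ l} {G : Baire → Vec ℕ n → Vec ℕ m} →
        Total* F → Total* G → Total* λ p v → F p (G p v)
app*ᵗ {F = F} {G} (cs , h) (ds , k) =
  composites cs , λ p v → evaluates cs p v (h p (G p v))
  where
  composites : ∀ {l} → Vec (Code _) l → Vec (Code _) l
  composites = map λ c → comp c ds
  evaluates : ∀ {l} (cs : Vec (Code _) l) p v {ys} → p ⊢ cs ·* G p v ⇓ ys →
              p ⊢ composites cs ·* v ⇓ ys
  evaluates []       p v ⇓[]       = ⇓[]
  evaluates (c ∷ cs) p v (⇓∷ e es) = ⇓∷ (⇓comp (k p v) e) (evaluates cs p v es)

headᵗ : ∀ {m n} {G : Baire → Vec ℕ n → Vec ℕ (suc m)} →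
        Total* G → Total λ p v → head (G p v)
headᵗ {G = G} (c ∷ cs , h) = c , λ p v → first (h p v)
  where
  first : ∀ {p v ys} → p ⊢ c ∷ cs ·* v ⇓ ys → p ⊢ c · v ⇓ head ys
  first (⇓∷ e _) = e

tailᵗ : ∀ {m n} {G : Baire → Vec ℕ n → Vec ℕ (suc m)} →
        Total* G → Total* λ p v → tailᵛ (G p v)
tailᵗ (c ∷ cs , h) = cs , λ p v → rest (h p v)
  where
  rest : ∀ {p v ys} → p ⊢ c ∷ cs ·* v ⇓ ys → p ⊢ cs ·* v ⇓ tailᵛ ys
  rest (⇓∷ _ es) = es

tabulateᵗ : ∀ {m n} (f : Fin m → Fin n) → Total* λ _ v → tabulate (lookup v ∘ f)
tabulateᵗ {zero}  f = []ᵗ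
tabulateᵗ {suc m} f = varᵗ (f zero) ∷ᵗ tabulateᵗ (f ∘ suc)

idᵗ : ∀ {n} → Total* {n} {n} λ _ v → v
idᵗ {n} with tabulateᵗ {n} id
... | cs , h = cs , λ p v → subst (p ⊢ cs ·* v ⇓_) (tabulate∘lookup v) (h p v)

weakenᵗ : ∀ {n} {F : Functional n} → Total F → Total λ p v → F p (tailᵛ v)
weakenᵗ F = appᵗ F (tailᵗ idᵗ)

app₁ : ∀ {n f} {A : Functional n} → Total₁ f → Total A → Total λ p v → f (A p v)
app₁ (total₁ f) a = appᵗ f (a ∷ᵗ []ᵗ)

app₂ : ∀ {n f} {A B : Functional n} → Total₂ f → Total A → Total B →
       Total λ p v → f (A p v) (B p v)
app₂ (total₂ f) a b = appᵗ f (a ∷ᵗ b ∷ᵗ []ᵗ)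

app₃ : ∀ {n f} {A B C : Functional n} → Total₃ f → Total A → Total B → Total C →
       Total λ p v → f (A p v) (B p v) (C p v)
app₃ (total₃ f) a b c = appᵗ f (a ∷ᵗ b ∷ᵗ c ∷ᵗ []ᵗ)

oracleᵗ : ∀ {n} {A : Functional n} → Total A → Total λ p v → p (A p v)
oracleᵗ a = appᵗ {F = λ p v → p (head v)} (oracle , λ { p (_ ∷ []) → ⇓oracle }) (a ∷ᵗ []ᵗ)

sucᵗ : Total₁ suc
sucᵗ = total₁ $ sucᶜ , λ { p (_ ∷ []) → ⇓suc }

zeroᵗ : ∀ {n} → Total {n} λ _ _ → 0
zeroᵗ = comp zeroᶜ [] , λ _ _ → ⇓comp ⇓[] ⇓zero

constᵗ : ∀ {n} k → Total {n} λ _ _ → k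
constᵗ zero    = zeroᵗ
constᵗ (suc k) = app₁ sucᵗ (constᵗ k)

-- This is the recursion scheme of `prec`; functions written with it obtain their programs from
-- `iterateᵗ`.
iterate : ℕ → (ℕ → ℕ → ℕ) → ℕ → ℕ
iterate b f zero    = b
iterate b f (suc n) = f n (iterate b f n)

iterateᵗ : ∀ {n} {B A : Functional n} {F : Functional (2 + n)} → Total B → Total F → Total A →
           Total λ p v → iterate (B p v) (λ k y → F p (k ∷ y ∷ v)) (A p v)
iterateᵗ {B = B} {F = F} (b , hb) (f , hf) a =
  appᵗ {F = λ p v → iterate (B p (tailᵛ v)) (λ k y → F p (k ∷ y ∷ tailᵛ v)) (head v)}
       (prec b f , λ { p (x ∷ v) → go p v x }) (a ∷ᵗ idᵗ)
  where
  go : ∀ p v x → p ⊢ prec b f · (x ∷ v) ⇓ iterate (B p v) (λ k y → F p (k ∷ y ∷ v)) x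
  go p v zero    = ⇓prec-zero (hb p v)
  go p v (suc x) = ⇓prec-suc (go p v x) (hf p _)

-- Arithmetic


x₀ : ∀ {n} → Total {1 + n} λ _ v → head v
x₀ = headᵗ idᵗ

x₁ : ∀ {n} → Total {2 + n} λ _ v → head (tailᵛ v)
x₁ = headᵗ (tailᵗ idᵗ)

x₂ : ∀ {n} → Total {3 + n} λ _ v → head (tailᵛ (tailᵛ v))
x₂ = headᵗ (tailᵗ (tailᵗ idᵗ))

predᵗ : Total₁ pred
predᵗ = total₁ $ total-resp (λ _ v → lemma (head v)) (iterateᵗ zeroᵗ x₀ x₀)
  where
  lemma : ∀ n → iterate 0 (λ k _ → k) n ≡ pred n
  lemma zero    = refl
  lemma (suc n) = refl

+ᵗ : Total₂ _+_
+ᵗ = total₂ $ total-resp (λ _ v → lemma (head v) (head (tailᵛ v))) (iterateᵗ x₁ (app₁ sucᵗ x₁) x₀)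
  where
  lemma : ∀ m n → iterate n (λ _ → suc) m ≡ m + n
  lemma zero    n = refl
  lemma (suc m) n = cong suc (lemma m n)

*ᵗ : Total₂ _*_
*ᵗ = total₂ $ total-resp (λ _ v → lemma (head v) (head (tailᵛ v)))
                (iterateᵗ zeroᵗ (app₂ +ᵗ (weakenᵗ (weakenᵗ x₁)) x₁) x₀)
  where
  lemma : ∀ m n → iterate 0 (λ _ → n +_) m ≡ m * n
  lemma zero    n = refl
  lemma (suc m) n = cong (n +_) (lemma m n)

∸ᵗ : Total₂ _∸_
∸ᵗ = total₂ $ total-resp (λ _ v → lemma (head v) (head (tailᵛ v))) (iterateᵗ x₀ (app₁ predᵗ x₁) x₁)
  where
  lemma : ∀ m n → iterate m (λ _ → pred) n ≡ m ∸ n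
  lemma m zero    = refl
  lemma m (suc n) = trans (cong pred (lemma m n)) (pred[m∸n]≡m∸[1+n] m n)

ifz : ℕ → ℕ → ℕ → ℕ
ifz zero    x y = x
ifz (suc _) x y = y

ifz-suc : ∀ n {x y} → ifz n 0 (suc x) ≡ suc y → ∃ λ m → n ≡ suc m × x ≡ y
ifz-suc (suc m) e = m , refl , suc-injective e

ifz-values : ∀ n {z} → (∀ {y} → n ≡ suc y → y ≡ z) → ifz n 0 (suc n) ≡ 0 ⊎ ifz n 0 (suc n) ≡ 2+ z
ifz-values zero    h = inj₁ refl
ifz-values (suc n) h = inj₂ (cong 2+ (h refl))

ifzᵗ : Total₃ ifz
ifzᵗ = total₃ $ total-resp (λ _ v → lemma (head v) _ _) (iterateᵗ x₁ (weakenᵗ (weakenᵗ x₂)) x₀)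
  where
  lemma : ∀ n x y → iterate x (λ _ _ → y) n ≡ ifz n x y
  lemma zero    x y = refl
  lemma (suc n) x y = refl

distance : ℕ → ℕ → ℕ
distance m n = (m ∸ n) + (n ∸ m)

distanceᵗ : Total₂ distance
distanceᵗ = total₂ $ app₂ +ᵗ (app₂ ∸ᵗ x₀ x₁) (app₂ ∸ᵗ x₁ x₀)

distance≡0⇒≡ : ∀ m n → distance m n ≡ 0 → m ≡ n
distance≡0⇒≡ m n e = ≤-antisym
  (m∸n≡0⇒m≤n (m+n≡0⇒m≡0 (m ∸ n) e)) (m∸n≡0⇒m≤n (m+n≡0⇒n≡0 (m ∸ n) e))

distance-≢ : ∀ {m n} → m ≢ n → ∃ λ d → distance m n ≡ suc d
distance-≢ {m} {n} ne with distance m n in eq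
... | zero  = contradiction (distance≡0⇒≡ m n eq) ne
... | suc d = d , refl

distance-refl : ∀ n → distance n n ≡ 0
distance-refl n = cong₂ _+_ (n∸n≡0 n) (n∸n≡0 n)

parity : ℕ → ℕ
parity = iterate 0 λ _ y → 1 ∸ y

parityᵗ : Total₁ parity
parityᵗ = total₁ $ iterateᵗ zeroᵗ (app₂ ∸ᵗ (constᵗ 1) x₁) x₀

-- Rounded down, the half grows exactly in the step from an odd number to its successor.
half : ℕ → ℕ
half = iterate 0 λ k y → parity k + y

halfᵗ : Total₁ half
halfᵗ = total₁ $ iterateᵗ zeroᵗ (app₂ +ᵗ (app₁ parityᵗ x₀) x₁) x₀

parity-binary : ∀ n → parity n ≡ 0 ⊎ parity n ≡ 1
parity-binary zero = inj₁ refl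
parity-binary (suc n) with parity n | parity-binary n
... | _ | inj₁ refl = inj₂ refl
... | _ | inj₂ refl = inj₁ refl

-- The induction hypothesis is taken for the swapped pair, following the recursion of `⟪_,_⟫`; the
-- parity changes at the same time.
⟪⟫-ifz : ∀ n f g → ifz (parity n) (f (half n)) (g (half n)) ≡ ⟪ f , g ⟫ n
⟪⟫-ifz zero f g = refl
⟪⟫-ifz (suc n) f g with parity n | parity-binary n | ⟪⟫-ifz n g (f ∘ suc)
... | _ | inj₁ refl | e = e
... | _ | inj₂ refl | e = e

⟪⟫ᵗ : ∀ {n} {A B : Functional (suc n)} → Total A → Total B →
      Total λ p v → ⟪ (λ x → A p (x ∷ tailᵛ v)) , (λ x → B p (x ∷ tailᵛ v)) ⟫ (head v)
⟪⟫ᵗ a b = total-resp (λ _ v → ⟪⟫-ifz (head v) _ _)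
  (app₃ ifzᵗ (app₁ parityᵗ x₀) (appᵗ a (app₁ halfᵗ x₀ ∷ᵗ tailᵗ idᵗ))
                               (appᵗ b (app₁ halfᵗ x₀ ∷ᵗ tailᵗ idᵗ)))

pair-unpair : ∀ c → ⟨ proj₁ (unpair c) , proj₂ (unpair c) ⟩ ≡ c
pair-unpair zero    = refl
pair-unpair (suc c) = trans (pair-next (proj₁ (unpair c)) (proj₂ (unpair c))) (cong suc (pair-unpair c))

-- Triangular numbers as iterated sums, so that the pairing function needs no program for division.
triangle : ℕ → ℕ
triangle = iterate 0 λ k y → suc (y + k)

triangleᵗ : Total₁ triangle
triangleᵗ = total₁ $ iterateᵗ zeroᵗ (app₁ sucᵗ (app₂ +ᵗ x₁ x₀)) x₀

triangle-pair : ∀ n k → triangle (n + k) + k ≡ ⟨ n , k ⟩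
triangle-pair n k = cong (_+ k) (lemma (n + k))
  where
  open import Data.Nat.DivMod using (_/_)
  lemma : ∀ s → triangle s ≡ (s * (s + 1)) / 2
  lemma zero    = refl
  lemma (suc s) = trans (cong (λ t → suc (t + s)) (lemma s)) (sym (triangle-suc s))

pairᵗ : Total₂ ⟨_,_⟩
pairᵗ = total₂ $ total-resp (λ _ v → triangle-pair (head v) _)
                   (app₂ +ᵗ (app₁ triangleᵗ (app₂ +ᵗ x₀ x₁)) x₁)

π₁ π₂ : ℕ → ℕ
π₁ c = proj₁ (unpair c)
π₂ c = proj₂ (unpair c)

π₁-pair : ∀ n k → π₁ ⟨ n , k ⟩ ≡ n
π₁-pair n k = cong proj₁ (unpair-pair n k)

π₂-pair : ∀ n k → π₂ ⟨ n , k ⟩ ≡ k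
π₂-pair n k = cong proj₂ (unpair-pair n k)

-- The walk moves to the next diagonal exactly when its first coordinate is 0.
diagonal : ℕ → ℕ
diagonal = iterate 0 λ c d → ifz (d ∸ (c ∸ triangle d)) (suc d) d

diagonalᵗ : Total₁ diagonal
diagonalᵗ = total₁ $ iterateᵗ zeroᵗ
  (app₃ ifzᵗ (app₂ ∸ᵗ x₁ (app₂ ∸ᵗ x₀ (app₁ triangleᵗ x₁))) (app₁ sucᵗ x₁) x₁) x₀

-- A code on diagonal d is `triangle d` plus its second coordinate, so subtraction recovers that
-- coordinate once the diagonal is known.
π₂-diagonal : ∀ c {d} → d ≡ π₁ c + π₂ c → c ∸ triangle d ≡ π₂ c
π₂-diagonal c refl =
  trans (cong (_∸ triangle (π₁ c + π₂ c))
              (trans (sym (pair-unpair c)) (sym (triangle-pair (π₁ c) (π₂ c)))))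
        (m+n∸m≡n (triangle (π₁ c + π₂ c)) _)

diagonal-unpair : ∀ c → diagonal c ≡ π₁ c + π₂ c
diagonal-unpair zero = refl
diagonal-unpair (suc c)
  rewrite π₂-diagonal c (diagonal-unpair c) | diagonal-unpair c
        | m+n∸n≡m (π₁ c) (π₂ c)
  with unpair c
... | zero  , k = cong suc (sym (+-identityʳ k))
... | suc n , k = sym (+-suc n k)

π₂ᵗ : Total₁ π₂
π₂ᵗ = total₁ $ total-resp (λ _ v → π₂-diagonal (head v) (diagonal-unpair (head v)))
  (app₂ ∸ᵗ x₀ (app₁ triangleᵗ (app₁ diagonalᵗ x₀)))

π₁ᵗ : Total₁ π₁
π₁ᵗ = total₁ $ total-resp (λ _ v → lemma (head v)) (app₂ ∸ᵗ (app₁ diagonalᵗ x₀) (app₁ π₂ᵗ x₀))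
  where
  lemma : ∀ c → diagonal c ∸ π₂ c ≡ π₁ c
  lemma c = trans (cong (_∸ π₂ c) (diagonal-unpair c)) (m+n∸n≡m (π₁ c) (π₂ c))

-- Bounded evaluation

-- Here g k is a result of `run`: 0 is undefined, 1 is the value 0 that ends the search, and more is
-- a positive value. State 0 means that the search goes on; every other state is kept.
scan : (ℕ → ℕ) → ℕ → ℕ
scan g = iterate 0 λ k y → ifz y (ifz (g k) 1 (ifz (pred (g k)) (2 + k) 0)) y

-- Only a test: it is 1 if all entries are nonzero, and 0 otherwise.
nonzero-product : ∀ {m} → Vec ℕ m → ℕ
nonzero-product []       = 1
nonzero-product (y ∷ ys) = ifz y 0 (nonzero-product ys)

-- The value is 0 if the evaluation needs more than s steps of an unbounded
-- search or oracle entries from s on, and one more than the result otherwise.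
mutual
  run : ∀ {n} → Code n → ℕ → Baire → Vec ℕ n → ℕ
  run zeroᶜ       s f xs = 1
  run sucᶜ        s f xs = 2 + head xs
  run oracle      s f xs = ifz (s ∸ head xs) 0 (suc (f (head xs)))
  run (proj i)    s f xs = suc (lookup xs i)
  run (comp g gs) s f xs = ifz (nonzero-product (run* gs s f xs)) 0
                               (run g s f (map pred (run* gs s f xs)))
  run (prec g h)  s f xs =
    iterate (run g s f (tailᵛ xs))
            (λ k y → ifz y 0 (run h s f (k ∷ pred y ∷ tailᵛ xs))) (head xs)
  -- The state 1 records an undefined value, and 2 + k that k was found.
  run (μ g)       s f xs = pred (scan (λ k → run g s f (k ∷ xs)) s)

  run* : ∀ {m n} → Vec (Code n) m → ℕ → Baire → Vec ℕ n → Vec ℕ m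
  run* []       s f xs = []
  run* (g ∷ gs) s f xs = run g s f xs ∷ run* gs s f xs

scan-searching : ∀ g k → scan g k ≡ 0 → ∀ {j} → j < k → ∃ λ v → g j ≡ 2 + v
scan-searching g (suc k) e lt with scan g k in eq
... | suc _ = contradiction e λ ()
... | zero with g k in eq′
...   | zero        = contradiction e λ ()
...   | suc zero    = contradiction e λ ()
...   | suc (suc v) with m≤n⇒m<n∨m≡n (≤-pred lt)
...     | inj₁ lt′  = scan-searching g k eq lt′
...     | inj₂ refl = v , eq′

scan-found : ∀ g k {x} → scan g k ≡ 2 + x → g x ≡ 1 × (∀ {j} → j < x → ∃ λ v → g j ≡ 2 + v)
scan-found g (suc k) e with scan g k in eq
... | suc y = scan-found g k (trans eq e)
... | zero with g k in eq′
...   | zero     = contradiction e λ ()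
...   | suc zero with refl ← e = eq′ , scan-searching g k eq
...   | suc (suc _) = contradiction e λ ()

scan-complete : ∀ g s x → (∀ {j} → j < x → ∃ λ v → g j ≡ 2 + v) → g x ≡ 1 →
                x < s → scan g s ≡ 2 + x
scan-complete g s x below at lt = stays (≤⇒≤′ lt)
  where
  searching : ∀ k → k ≤ x → scan g k ≡ 0
  searching zero    le = refl
  searching (suc k) le
    rewrite searching k (<⇒≤ le) | proj₂ (below le) = refl
  stays : ∀ {s} → suc x ≤′ s → scan g s ≡ 2 + x
  stays ≤′-refl rewrite searching x ≤-refl | at = refl
  stays (≤′-step le) rewrite stays le = refl

mutual
  run-sound : ∀ {n} (c : Code n) {s f} xs {z} → run c s f xs ≡ suc z → f ⊢ c · xs ⇓ z
  run-sound zeroᶜ [] refl = ⇓zero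
  run-sound sucᶜ (x ∷ []) refl = ⇓suc
  run-sound oracle {s} (x ∷ []) e with s ∸ x
  run-sound oracle {s} (x ∷ []) refl | suc _ = ⇓oracle
  run-sound (proj i) xs refl = ⇓proj
  run-sound (comp g gs) {s} {f} xs e with nonzero-product (run* gs s f xs) in eq
  ... | suc _ = ⇓comp (run*-sound gs xs eq) (run-sound g _ e)
  run-sound (prec g h) (x ∷ xs) e = prec-sound g h x xs e
  run-sound (μ g) {s} {f} xs e with scan (λ k → run g s f (k ∷ xs)) s in eq
  run-sound (μ g) {s} {f} xs refl | suc (suc x) =
    let found , below = scan-found _ s eq in
    -- Two predecessors: one undoes the shift of `run`, the other is asked for by `⇓μ`, which
    -- records positive values minus one.
    ⇓μ (λ k → pred (pred (run g s f (k ∷ xs))))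
       (λ {k} lt → run-sound g (k ∷ xs)
         (let v , e = below lt in trans e (cong 2+ (sym (cong (pred ∘ pred) e)))))
       (run-sound g (x ∷ xs) found)

  prec-sound : ∀ {n} (g : Code n) h {s f} x xs {z} →
               run (prec g h) s f (x ∷ xs) ≡ suc z → f ⊢ prec g h · (x ∷ xs) ⇓ z
  prec-sound g h zero xs e = ⇓prec-zero (run-sound g xs e)
  prec-sound g h {s} {f} (suc x) xs e with run (prec g h) s f (x ∷ xs) in eq
  ... | suc y = ⇓prec-suc (prec-sound g h x xs eq) (run-sound h (x ∷ y ∷ xs) e)

  run*-sound : ∀ {m n} (gs : Vec (Code n) m) {s f} xs {z} →
               nonzero-product (run* gs s f xs) ≡ suc z →
               f ⊢ gs ·* xs ⇓ map pred (run* gs s f xs)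
  run*-sound [] xs e = ⇓[]
  run*-sound (g ∷ gs) {s} {f} xs e with run g s f xs in eq
  ... | suc y = ⇓∷ (run-sound g xs eq) (run*-sound gs xs e)

-- Completeness of `run` is stated for all large s rather than for some s. The bounds for the parts
-- of a computation then combine by maxima, without a monotonicity lemma for `run`.
Eventually : (ℕ → Set) → Set
Eventually P = ∃ λ s₀ → ∀ {s} → s₀ ≤ s → P s

eventually-× : ∀ {P Q : ℕ → Set} → Eventually P → Eventually Q → Eventually λ s → P s × Q s
eventually-× (a , f) (b , g) =
  a ⊔ b , λ le → f (≤-trans (m≤m⊔n a b) le) , g (≤-trans (m≤n⊔m a b) le)

eventually-map : ∀ {P Q : ℕ → Set} → (∀ s → P s → Q s) → Eventually P → Eventually Q
eventually-map h (a , f) = a , λ le → h _ (f le)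

eventually-below : ∀ {P : ℕ → ℕ → Set} x → (∀ {k} → k < x → Eventually (P k)) →
                   Eventually λ s → ∀ {k} → k < x → P k s
eventually-below zero h = 0 , λ _ ()
eventually-below {P} (suc x) h =
  eventually-map (λ s (f , p) {k} lt → last {s} f p (m≤n⇒m<n∨m≡n (≤-pred lt)))
    (eventually-× (eventually-below x λ lt → h (m≤n⇒m≤1+n lt)) (h ≤-refl))
  where
  last : ∀ {s k} → (∀ {k} → k < x → P k s) → P x s → k < x ⊎ k ≡ x → P k s
  last f p (inj₁ lt)   = f lt
  last f p (inj₂ refl) = p

mutual
  run-complete : ∀ {n} {c : Code n} {f xs z} → f ⊢ c · xs ⇓ z →
                 Eventually λ s → run c s f xs ≡ suc z
  run-complete ⇓zero = 0 , λ _ → refl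
  run-complete ⇓suc  = 0 , λ _ → refl
  run-complete (⇓oracle {x}) = suc x , λ {s} lt → positive s lt
    where
    positive : ∀ s {y} → x < s → ifz (s ∸ x) 0 (suc y) ≡ suc y
    positive s lt with s ∸ x in eq
    ... | zero  = contradiction (m∸n≡0⇒m≤n eq) (<⇒≱ lt)
    ... | suc _ = refl
  run-complete ⇓proj = 0 , λ _ → refl
  run-complete (⇓comp {f = g} {gs} {xs} es e) =
    eventually-map (λ where _ ((a , b) , d) → step a b d)
      (eventually-× (run*-complete es) (run-complete e))
    where
    step : ∀ {s f ys z} → nonzero-product (run* gs s f xs) ≡ 1 →
           map pred (run* gs s f xs) ≡ ys → run g s f ys ≡ suc z →
           run (comp g gs) s f xs ≡ suc z
    step a refl d rewrite a = d
  run-complete (⇓prec-zero e) = run-complete e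
  run-complete (⇓prec-suc {f = g} {h} {x} {xs} {y} e e′) =
    eventually-map (λ _ (a , b) → step a b) (eventually-× (run-complete e) (run-complete e′))
    where
    step : ∀ {s f z} → run (prec g h) s f (x ∷ xs) ≡ suc y →
           run h s f (x ∷ y ∷ xs) ≡ suc z → run (prec g h) s f (suc x ∷ xs) ≡ suc z
    step a b rewrite a = b
  run-complete {f = f} (⇓μ {f = g} {xs} {x} ys es e) =
    eventually-map (λ where _ ((below , at) , lt) →
                              cong pred (scan-complete _ _ x (λ lt → _ , below lt) at lt))
      (eventually-× (eventually-× (eventually-below {λ k s → run g s f (k ∷ xs) ≡ 2 + ys k} x
                                     λ lt → run-complete (es lt))
                                  (run-complete e))
                    (suc x , id))

  run*-complete : ∀ {m n} {gs : Vec (Code n) m} {f xs ys} → f ⊢ gs ·* xs ⇓ ys →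
                  Eventually λ s → nonzero-product (run* gs s f xs) ≡ 1 ×
                                   map pred (run* gs s f xs) ≡ ys
  run*-complete ⇓[] = 0 , λ _ → refl , refl
  run*-complete (⇓∷ {g = g} {gs} {xs} {y} {ys} e es) =
    eventually-map (λ _ (a , b , c) → step a b c)
                   (eventually-× (run-complete e) (run*-complete es))
    where
    step : ∀ {s f} → run g s f xs ≡ suc y → nonzero-product (run* gs s f xs) ≡ 1 →
           map pred (run* gs s f xs) ≡ ys →
           nonzero-product (run* (g ∷ gs) s f xs) ≡ 1 ×
           map pred (run* (g ∷ gs) s f xs) ≡ y ∷ ys
    step a b c rewrite a = b , cong (y ∷_) c

AgreeBelow : ℕ → Baire → Baire → Set
AgreeBelow s f g = ∀ {x} → x < s → f x ≡ g x

iterate-cong : ∀ {b b′ f g} n → b ≡ b′ → (∀ k y → f k y ≡ g k y) →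
               iterate b f n ≡ iterate b′ g n
iterate-cong zero    e h = e
iterate-cong {g = g} (suc n) e h = trans (h n _) (cong (g n) (iterate-cong n e h))

mutual
  -- The use principle: with bound s, the oracle clause gives up on entries from s on. The
  -- compactness arguments rest on this.
  run-local : ∀ {n} (c : Code n) {s f g} → AgreeBelow s f g → ∀ xs → run c s f xs ≡ run c s g xs
  run-local zeroᶜ h xs = refl
  run-local sucᶜ h xs = refl
  run-local oracle {s} h (x ∷ []) with s ∸ x in eq
  ... | zero  = refl
  ... | suc _ = cong suc (h (m∸n≢0⇒n<m λ e → contradiction (trans (sym eq) e) λ ()))
  run-local (proj i) h xs = refl
  run-local (comp c cs) h xs rewrite run*-local cs h xs =
    cong (ifz _ 0) (run-local c h _)
  run-local (prec c d) h xs =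
    iterate-cong (head xs) (run-local c h _) λ k y → cong (ifz y 0) (run-local d h _)
  run-local (μ c) {s} h xs =
    cong pred (iterate-cong s refl λ k y →
      cong (λ v → ifz y (ifz v 1 (ifz (pred v) (2 + k) 0)) y) (run-local c h (k ∷ xs)))

  run*-local : ∀ {m n} (cs : Vec (Code n) m) {s f g} → AgreeBelow s f g → ∀ xs →
               run* cs s f xs ≡ run* cs s g xs
  run*-local []       h xs = refl
  run*-local (c ∷ cs) h xs = cong₂ _∷_ (run-local c h xs) (run*-local cs h xs)

map-predᵗ : ∀ {m n} {X : Baire → Vec ℕ n → Vec ℕ m} → Total* X → Total* λ p v → map pred (X p v)
map-predᵗ {X = X} ([] , h) = [] , λ p v → subst (p ⊢ [] ·* v ⇓_) (empty (map pred (X p v))) ⇓[]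
  where
  empty : ∀ ys → [] ≡ ys
  empty [] = refl
map-predᵗ {X = X} x@(_ ∷ _ , _) =
  total*-resp (λ p v → split (X p v)) (app₁ predᵗ (headᵗ x) ∷ᵗ map-predᵗ (tailᵗ x))
  where
  split : ∀ {m} (ys : Vec ℕ (suc m)) → pred (head ys) ∷ map pred (tailᵛ ys) ≡ map pred ys
  split (_ ∷ _) = refl

nonzero-productᵗ : ∀ {m n} {X : Baire → Vec ℕ n → Vec ℕ m} → Total* X →
                   Total λ p v → nonzero-product (X p v)
nonzero-productᵗ {X = X} ([] , h) = total-resp (λ p v → empty (X p v)) (constᵗ 1)
  where
  empty : ∀ ys → 1 ≡ nonzero-product ys
  empty [] = refl
nonzero-productᵗ {X = X} x@(_ ∷ _ , _) =
  total-resp (λ p v → split (X p v)) (app₃ ifzᵗ (headᵗ x) zeroᵗ (nonzero-productᵗ (tailᵗ x)))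
  where
  split : ∀ {m} (ys : Vec ℕ (suc m)) →
          ifz (head ys) 0 (nonzero-product (tailᵛ ys)) ≡ nonzero-product ys
  split (_ ∷ _) = refl

mutual
  -- As c is fixed, its evaluator is assembled by recursion on c, and programs need not be coded as
  -- numbers. The simulated oracle A may depend on the parameters, which is why it is shifted under
  -- the binders of `iterateᵗ`.
  runᵗ : ∀ {m n} (c : Code n) {S : Functional m} {A : Functional (suc m)}
         {X : Baire → Vec ℕ m → Vec ℕ n} → Total S → Total A → Total* X →
         Total λ p v → run c (S p v) (λ x → A p (x ∷ v)) (X p v)
  runᵗ zeroᶜ s a x = constᵗ 1
  runᵗ sucᶜ s a x = app₁ sucᵗ (app₁ sucᵗ (headᵗ x))
  runᵗ oracle s a x = app₃ ifzᵗ (app₂ ∸ᵗ s (headᵗ x)) zeroᵗ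
                                (app₁ sucᵗ (appᵗ a (headᵗ x ∷ᵗ idᵗ)))
  runᵗ (proj i) s a x = app₁ sucᵗ (appᵗ (varᵗ i) x)
  runᵗ (comp c cs) s a x = app₃ ifzᵗ (nonzero-productᵗ (run*ᵗ cs s a x)) zeroᵗ
                                     (runᵗ c s a (map-predᵗ (run*ᵗ cs s a x)))
  runᵗ (prec c d) s a x =
    iterateᵗ (runᵗ c s a (tailᵗ x))
      (app₃ ifzᵗ x₁ zeroᵗ
        (runᵗ d (appᵗ s drop₂) (appᵗ a (x₀ ∷ᵗ tailᵗ (tailᵗ (tailᵗ idᵗ))))
          (x₀ ∷ᵗ app₁ predᵗ x₁ ∷ᵗ app*ᵗ (tailᵗ x) drop₂)))
      (headᵗ x)
    where drop₂ = tailᵗ (tailᵗ idᵗ)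
  runᵗ (μ c) {S} {A} {X} s a x =
    app₁ predᵗ (iterateᵗ zeroᵗ
      (app₃ ifzᵗ x₁ (app₃ ifzᵗ step (constᵗ 1)
                      (app₃ ifzᵗ (app₁ predᵗ step) (app₁ sucᵗ (app₁ sucᵗ x₀)) zeroᵗ)) x₁)
      s)
    where
    drop₂ = tailᵗ (tailᵗ idᵗ)
    step = runᵗ c (appᵗ s drop₂) (appᵗ a (x₀ ∷ᵗ tailᵗ (tailᵗ (tailᵗ idᵗ))))
                  (x₀ ∷ᵗ app*ᵗ x drop₂)

  run*ᵗ : ∀ {l m n} (cs : Vec (Code n) l) {S : Functional m} {A : Functional (suc m)}
          {X : Baire → Vec ℕ m → Vec ℕ n} → Total S → Total A → Total* X →
          Total* λ p v → run* cs (S p v) (λ x → A p (x ∷ v)) (X p v)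
  run*ᵗ []       s a x = []ᵗ
  run*ᵗ (c ∷ cs) s a x = runᵗ c s a x ∷ᵗ run*ᵗ cs s a x

-- Unbounded search

zero?ᵗ : ∀ {n} {F : Functional n} → Total F → Total λ p v → ifz (F p v) 1 0
zero?ᵗ t = app₃ ifzᵗ t (constᵗ 1) zeroᵗ

least-nonzero : ∀ (g : ℕ → ℕ) s → g s ≢ 0 → ∃ λ k → g k ≢ 0 × (∀ {j} → j < k → g j ≡ 0)
least-nonzero g s ne with below (suc s)
  where
  below : ∀ s → (∀ {j} → j < s → g j ≡ 0) ⊎ ∃ λ k → g k ≢ 0 × (∀ {j} → j < k → g j ≡ 0)
  below zero = inj₁ λ ()
  below (suc s) with below s
  ... | inj₂ found = inj₂ found
  ... | inj₁ none with g s ≟ 0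
  ...   | no ne = inj₂ (s , ne , none)
  ...   | yes e = inj₁ λ lt → case m≤n⇒m<n∨m≡n (≤-pred lt) of λ where
                    (inj₁ lt′)  → none lt′
                    (inj₂ refl) → e
... | inj₁ none  = contradiction (none ≤-refl) ne
... | inj₂ found = found

-- The predecessor of the first nonzero value of F in its first argument.
searchᶜ : ∀ {n} {F : Functional (suc n)} → Total F → Code n
searchᶜ t = comp (code (app₁ predᵗ (x₀ {0})))
  (comp (code t) (μ (code (zero?ᵗ t)) ∷ Total*.codes idᵗ) ∷ [])

-- The given s only guarantees termination. The search may stop earlier, so all that is known of the
-- result z is that it comes from a nonzero value of F.
search-⇓ : ∀ {n} {F : Functional (suc n)} (t : Total F) {p v s} → F p (s ∷ v) ≢ 0 →
           ∃₂ λ s z → F p (s ∷ v) ≡ suc z × p ⊢ searchᶜ t · v ⇓ z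
search-⇓ {F = F} t {p} {v} {s} ne with least-nonzero (λ s → F p (s ∷ v)) s ne
... | k , found , below with F p (k ∷ v) in eq
...   | zero  = contradiction refl found
...   | suc z = k , z , eq , ⇓comp (⇓∷ (⇓comp (⇓∷ least (Total*.computes idᵗ p v))
                                              (subst (p ⊢ code t · (k ∷ v) ⇓_) eq (computes t p _)))
                                       ⇓[])
                                   (computes (app₁ predᵗ (x₀ {0})) p (suc z ∷ []))
  where
  least : p ⊢ μ (code (zero?ᵗ t)) · v ⇓ k
  least = ⇓μ (λ _ → 0)
    (λ lt → subst (p ⊢ _ · _ ⇓_) (cong (λ y → ifz y 1 0) (below lt)) (computes (zero?ᵗ t) p _))
    (subst (p ⊢ _ · _ ⇓_) (cong (λ y → ifz y 1 0) eq) (computes (zero?ᵗ t) p _))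

search-nonzero : ∀ {n} {F : Functional (suc n)} (t : Total F) {p v z} →
                 p ⊢ searchᶜ t · v ⇓ z → ∃ λ s → F p (s ∷ v) ≢ 0
search-nonzero {F = F} t {p} {v}
               (⇓comp (⇓∷ (⇓comp (⇓∷ (⇓μ {x = k} _ _ e) _) _) ⇓[]) _) =
  k , λ eq → contradiction
    (trans (cong (λ y → ifz y 1 0) (sym eq)) (⇓-deterministic (computes (zero?ᵗ t) p (k ∷ v)) e))
    λ ()

-- Bounded sums and products

-- Reading nonzero as true, bounded sums act as existential and bounded products as universal
-- quantifiers.
sumBelow : ℕ → (ℕ → ℕ) → ℕ
sumBelow n g = iterate 0 (λ k y → y + g k) n

productBelow : ℕ → (ℕ → ℕ) → ℕ
productBelow n g = iterate 1 (λ k y → y * g k) n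

sumBelowᵗ : ∀ {n} {N : Functional n} {F : Functional (suc n)} → Total N → Total F →
            Total λ p v → sumBelow (N p v) (λ k → F p (k ∷ v))
sumBelowᵗ n f = iterateᵗ zeroᵗ (app₂ +ᵗ x₁ (appᵗ f (x₀ ∷ᵗ tailᵗ (tailᵗ idᵗ)))) n

productBelowᵗ : ∀ {n} {N : Functional n} {F : Functional (suc n)} → Total N → Total F →
                Total λ p v → productBelow (N p v) (λ k → F p (k ∷ v))
productBelowᵗ n f = iterateᵗ (constᵗ 1) (app₂ *ᵗ x₁ (appᵗ f (x₀ ∷ᵗ tailᵗ (tailᵗ idᵗ)))) n

≤-sumBelow : ∀ n g {k} → k < n → g k ≤ sumBelow n g
≤-sumBelow (suc n) g {k} lt = case m≤n⇒m<n∨m≡n (≤-pred lt) of λ where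
  (inj₁ lt′)  → ≤-trans (≤-sumBelow n g lt′) (m≤m+n _ (g n))
  (inj₂ refl) → m≤n+m (g n) _

sumBelow-nonzero : ∀ n g → sumBelow n g ≢ 0 → ∃ λ k → k < n × g k ≢ 0
sumBelow-nonzero zero g ne = contradiction refl ne
sumBelow-nonzero (suc n) g ne = case g n ≟ 0 of λ where
  (no ne′) → n , ≤-refl , ne′
  (yes e)  → let k , lt , ne′ = sumBelow-nonzero n g λ e′ → ne (cong₂ _+_ e′ e) in
             k , m≤n⇒m≤1+n lt , ne′

productBelow-nonzero : ∀ n g → (∀ {k} → k < n → g k ≢ 0) → productBelow n g ≢ 0
productBelow-nonzero (suc n) g ne e = case m*n≡0⇒m≡0∨n≡0 (productBelow n g) e of λ where
  (inj₁ z) → productBelow-nonzero n g (λ lt → ne (m≤n⇒m≤1+n lt)) z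
  (inj₂ z) → ne ≤-refl z

productBelow-factor : ∀ n g {k} → productBelow n g ≢ 0 → k < n → g k ≢ 0
productBelow-factor (suc n) g ne lt e = case m≤n⇒m<n∨m≡n (≤-pred lt) of λ where
  (inj₁ lt′)  → productBelow-factor n g (λ z → ne (cong (_* g n) z)) lt′ e
  (inj₂ refl) → ne (trans (cong (productBelow n g *_) e) (*-zeroʳ (productBelow n g)))

-- Cantor space

Binary : Baire → Set
Binary f = ∀ n → f n ≡ 0 ⊎ f n ≡ 1

halves : ℕ → ℕ → ℕ
halves n w = iterate w (λ _ → half) n

bits : ℕ → Baire
bits w n = parity (halves n w)

bitsᵗ : ∀ {n} {W N : Functional n} → Total W → Total N → Total λ p v → bits (W p v) (N p v)
bitsᵗ w n = app₁ parityᵗ (iterateᵗ w (app₁ halfᵗ x₁) n)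

bits-binary : ∀ w → Binary (bits w)
bits-binary w n = parity-binary (halves n w)

pow2 : ℕ → ℕ
pow2 = iterate 1 λ _ y → y + y

pow2ᵗ : Total₁ pow2
pow2ᵗ = total₁ $ iterateᵗ (constᵗ 1) (app₂ +ᵗ x₁ x₁) x₀

-- The prefix of length n as a binary numeral with the lowest digit first. Thus the numbers below
-- `pow2 n` enumerate all binary strings of length n, and `bits` reads them.
encode : ℕ → Baire → ℕ
encode zero    f = 0
encode (suc n) f = f 0 + (encode n (f ∘ suc) + encode n (f ∘ suc))

parity-double : ∀ n → parity (n + n) ≡ 0
parity-double zero    = refl
parity-double (suc n) rewrite +-suc n n | parity-double n = refl

half-double : ∀ n → half (n + n) ≡ n
half-double zero    = refl
half-double (suc n) rewrite +-suc n n | parity-double n | half-double n = refl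

halves-half : ∀ n w → halves (suc n) w ≡ halves n (half w)
halves-half zero    w = refl
halves-half (suc n) w = cong half (halves-half n w)

bits-encode : ∀ n {f} → Binary f → AgreeBelow n (bits (encode n f)) f
bits-encode (suc n) {f} bin {zero} lt with f 0 | bin 0
... | _ | inj₁ refl = parity-double (encode n (f ∘ suc))
... | _ | inj₂ refl = cong (1 ∸_) (parity-double (encode n (f ∘ suc)))
bits-encode (suc n) {f} bin {suc x} lt =
  trans (cong parity (trans (halves-half x (encode (suc n) f)) (cong (halves x) half-encode)))
        (bits-encode n (bin ∘ suc) (≤-pred lt))
  where
  half-encode : half (encode (suc n) f) ≡ encode n (f ∘ suc)
  half-encode with f 0 | bin 0
  ... | _ | inj₁ refl = half-double (encode n (f ∘ suc))
  ... | _ | inj₂ refl = trans (cong (_+ half (encode n (f ∘ suc) + encode n (f ∘ suc)))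
                                    (parity-double (encode n (f ∘ suc))))
                              (half-double (encode n (f ∘ suc)))

encode-< : ∀ n {f} → Binary f → encode n f < pow2 n
encode-< zero    bin = ≤-refl
encode-< (suc n) {f} bin = ≤-trans (s≤s (bound (f 0) (bin 0) (encode n (f ∘ suc))))
  (+-mono-≤ (encode-< n (bin ∘ suc)) (encode-< n (bin ∘ suc)))
  where
  bound : ∀ b → b ≡ 0 ⊎ b ≡ 1 → ∀ e → b + (e + e) ≤ e + suc e
  bound _ (inj₁ refl) e = +-monoʳ-≤ e (n≤1+n e)
  bound _ (inj₂ refl) e = ≤-reflexive (sym (+-suc e e))

-- Compactness of Cantor space

module _ (em : ExcludedMiddle 0ℓ) where

  counterexample : ∀ {A : Set} {P : A → Set} → ¬ (∀ a → P a) → ∃ λ a → ¬ P a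
  counterexample h = decidable-stable em λ none → h λ a → decidable-stable em λ ¬p → none (a , ¬p)

  module _ (C : ℕ → Baire → Set) (antitone : ∀ {m n f} → m ≤ n → C n f → C m f)
           (local : ∀ {n f g} → AgreeBelow n f g → C n f → C n g) where

    -- The prefix of g of length k has extensions in all C n.
    Extendible : ℕ → Baire → Set
    Extendible k g = ∀ n → ∃ λ f → Binary f × AgreeBelow k f g × C n f

    -- If appending 0 fails at level n₀, it fails at all later levels because C decreases. Hence the
    -- witnesses for the levels n ⊔ n₀ all continue with 1.
    extend : ∀ k g → Extendible k g →
             ∃ λ g′ → AgreeBelow k g′ g × (g′ k ≡ 0 ⊎ g′ k ≡ 1) × Extendible (suc k) g′
    extend k g ext = case em {With 0} of λ where
        (yes w) → choose w (inj₁ refl)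
        (no ¬w) → let n₀ , none = counterexample ¬w in choose
          (λ n → let f , bin , agree , c = ext (n ⊔ n₀) in
            f , bin , agree , other (bin k) (λ e → none (f , bin , agree , e , antitone (m≤n⊔m n n₀) c)) ,
            antitone (m≤m⊔n n n₀) c)
          (inj₂ refl)
      where
      With : ℕ → Set
      With b = ∀ n → ∃ λ f → Binary f × AgreeBelow k f g × f k ≡ b × C n f

      other : ∀ {b} → b ≡ 0 ⊎ b ≡ 1 → b ≢ 0 → b ≡ 1
      other (inj₁ e) ne = contradiction e ne
      other (inj₂ e) ne = e

      choose : ∀ {b} → With b → b ≡ 0 ⊎ b ≡ 1 →
               ∃ λ g′ → AgreeBelow k g′ g × (g′ k ≡ 0 ⊎ g′ k ≡ 1) × Extendible (suc k) g′
      -- All witnesses share the first k + 1 entries, so the one at level 0 may represent the longer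
      -- prefix.
      choose w bin with w 0
      ... | g′ , bin′ , agree′ , e′ , _ = g′ , agree′ , bin′ k , λ n →
        let f , bin , agree , e , c = w n in
        f , bin , (λ lt → case m≤n⇒m<n∨m≡n (≤-pred lt) of λ where
          (inj₁ lt′)  → trans (agree lt′) (sym (agree′ lt′))
          (inj₂ refl) → trans e (sym e′)) , c

    -- König's lemma: `path` is the limit of extendible prefixes. Since C n depends only on the
    -- first n entries, it passes to `path` from a witness extending the prefix of length n.
    compactness : (∀ n → ∃ λ f → Binary f × C n f) → ∃ λ f → Binary f × ∀ n → C n f
    compactness h = path , (λ k → proj₁ (proj₂ (proj₂ (step k)))) , λ n →
      let f , _ , agree , c = proj₂ (prefix n) n in
      local (λ lt → trans (agree lt) (prefix-path n lt)) c
      where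
      prefix : ∀ k → ∃ (Extendible k)
      step : ∀ k → ∃ λ g′ → AgreeBelow k g′ (proj₁ (prefix k)) × (g′ k ≡ 0 ⊎ g′ k ≡ 1) ×
                            Extendible (suc k) g′
      prefix zero    = (λ _ → 0) , λ n → let f , bin , c = h n in f , bin , (λ ()) , c
      prefix (suc k) = let g , _ , _ , ext = step k in g , ext
      step k = extend k (proj₁ (prefix k)) (proj₂ (prefix k))

      path : Baire
      path k = proj₁ (step k) k

      prefix-path : ∀ k → AgreeBelow k (proj₁ (prefix k)) path
      prefix-path (suc k) lt = case m≤n⇒m<n∨m≡n (≤-pred lt) of λ where
        (inj₁ lt′)  → trans (proj₁ (proj₂ (step k)) lt′) (prefix-path k lt′)
        (inj₂ refl) → refl

-- Reductions

open RepresentedSpace using (δ; δ-resp)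

operator : (D : Baire → Baire) → Total {1} (λ p v → D p (head v)) → Baire⇀Baire
operator D t = record
  { graph      = λ p q → q ≗ D p
  ; resp       = λ e f h n → trans (sym (f n)) (trans (h n) (total-cong t (n ∷ []) e))
  ; functional = λ h h′ n → trans (h n) (sym (h′ n))
  }

operator-computable : ∀ {D} t → Computable (operator D t)
operator-computable t =
  code t , λ p q h n → subst (p ⊢ code t · _ ⇓_) (sym (h n)) (computes t p (n ∷ []))

-- Unlike in `⟪⟫ᵗ`, the two programs may be partial; they need to compute total functions only for
-- the oracle at hand.
↦-join : Code 1 → Code 1 → Code 1
↦-join c d = comp (code (app₃ ifzᵗ (x₀ {2}) x₁ x₂))
  (code (app₁ parityᵗ (x₀ {0})) ∷ comp c (code (app₁ halfᵗ (x₀ {0})) ∷ []) ∷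
   comp d (code (app₁ halfᵗ (x₀ {0})) ∷ []) ∷ [])

↦-join-⇓ : ∀ {p a b c d} → p ⊢ c ↦ a → p ⊢ d ↦ b → p ⊢ ↦-join c d ↦ ⟪ a , b ⟫
↦-join-⇓ {p} {a} {b} h k n = subst (p ⊢ ↦-join _ _ · _ ⇓_) (⟪⟫-ifz n a b)
  (⇓comp (⇓∷ (computes (app₁ parityᵗ x₀) p _)
         (⇓∷ (⇓comp (⇓∷ (computes (app₁ halfᵗ x₀) p _) ⇓[]) (h _))
         (⇓∷ (⇓comp (⇓∷ (computes (app₁ halfᵗ x₀) p _) ⇓[]) (k _)) ⇓[])))
         (computes (app₃ ifzᵗ x₀ x₁ x₂) p _))

evensᵗ : ∀ {n} {A : Functional n} → Total A → Total λ p v → evens p (A p v)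
evensᵗ a = oracleᵗ (app₂ *ᵗ (constᵗ 2) a)

oddsᵗ : ∀ {n} {A : Functional n} → Total A → Total λ p v → odds p (A p v)
oddsᵗ a = oracleᵗ (app₁ sucᵗ (app₂ *ᵗ (constᵗ 2) a))

≤T-total : ∀ {D : Baire → Baire} → Total {1} (λ p v → D p (head v)) → ∀ p → D p ≤T p
≤T-total t p = code t , λ n → computes t p (n ∷ [])

module _ {X Y V W : RepresentedSpace} {f : X ⇉ Y} {g : V ⇉ W} where

  -- For reductions by total functionals only names have to be checked. The outer functional sees p
  -- and q as the halves of `⟪ p , q ⟫`, which agree with them only pointwise; this is why names are
  -- transported here.
  ≤W-by : (K : Baire → Baire) (H : Baire → Baire → Baire) →
          Total {1} (λ p v → K p (head v)) →
          Total {1} (λ r v → H (evens r) (odds r) (head v)) →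
          (∀ {p x} → δ X p x → dom f x → ∃ λ v → δ V (K p) v × dom g v) →
          (∀ {p x v q y} → δ X p x → dom f x → δ V (K p) v → δ W q y → g ∋ v ↦ y →
           ∃ λ z → δ Y (H p q) z × f ∋ x ↦ z) →
          f ≤W g
  ≤W-by K H k h query solve =
    operator (λ r → H (evens r) (odds r)) h , operator K k ,
    operator-computable h , operator-computable k , λ G real p x d dm →
    let v , dv , dmv       = query d dm
        q , Gq , y , dq , gy = real (K p) v dv dmv
        p≗ = sym ∘ ⟪⟫-even p q
    in _ , (⟪ p , q ⟫ , (q , (K p , (λ _ → refl) , Gq) , λ _ → refl) , λ _ → refl) ,
       solve (δ-resp X p≗ (RepresentedSpace.Eq.refl X) d) dm
             (δ-resp V (λ n → total-cong k (n ∷ []) p≗) (RepresentedSpace.Eq.refl V) dv)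
             (δ-resp W (sym ∘ ⟪⟫-odd p q) (RepresentedSpace.Eq.refl W) dq) gy

  ≤sW-by : (K H : Baire → Baire) →
           Total {1} (λ p v → K p (head v)) → Total {1} (λ p v → H p (head v)) →
           (∀ {p x} → δ X p x → dom f x → ∃ λ v → δ V (K p) v × dom g v) →
           (∀ {p x v q y} → δ X p x → dom f x → δ V (K p) v → δ W q y → g ∋ v ↦ y →
            ∃ λ z → δ Y (H q) z × f ∋ x ↦ z) →
           f ≤sW g
  ≤sW-by K H k h query solve =
    operator H h , operator K k , operator-computable h , operator-computable k ,
    λ G real p x d dm →
    let v , dv , dmv       = query d dm
        q , Gq , y , dq , gy = real (K p) v dv dmv
    in H q , (q , (K p , (λ _ → refl) , Gq) , λ _ → refl) , solve d dm dv dq gy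

  -- One realizer of g exists, and changing its value at the query K p to any
  -- admissible answer q gives another one.
  ≤W-answers : ExcludedMiddle 0ℓ → (∃ λ G → Realizes G g) → f ≤W g →
    ∃₂ λ (h k : Code 1) → ∀ p x → δ X p x → dom f x →
    ∃ λ r → p ⊢ k ↦ r × (∀ v q y → δ V r v → δ W q y → g ∋ v ↦ y →
      ∃₂ λ s z → ⟪ p , q ⟫ ⊢ h ↦ s × δ Y s z × f ∋ x ↦ z)
  ≤W-answers em (G₀ , real₀) (H , K , (h , ch) , (k , ck) , red) =
    h , k , λ p x d dm → case red G₀ real₀ p x d dm of λ where
      (_ , (_ , (_ , (r , Kr , _) , _) , _) , _) → r , ck p r Kr , λ v q y dr dq gy →
        case red (modified r q) (modified-realizes dr dq gy) p x d dm of λ where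
          (s , (t , (q′ , (r′ , Kr′ , Gq′) , t≗) , Ht) , z , ds , fz) →
            s , z ,
            (λ n → ⇓-resp (λ m → trans (t≗ m) (⟪⟫-cong (λ _ → refl)
                             (modified-value {r} {q} {r′} (K.functional Kr′ Kr) Gq′) m))
                          (ch t s Ht n)) ,
            ds , fz
    where
    module K = Baire⇀Baire K
    module G₀ = Baire⇀Baire G₀

    modified : Baire → Baire → Baire⇀Baire
    modified r q = record
      { graph      = λ a b → (a ≗ r × b ≗ q) ⊎ (¬ (a ≗ r) × G₀ ⟦ a ↦ b ⟧)
      ; resp       = λ where
          e e′ (inj₁ (a , b)) → inj₁ ((λ n → trans (sym (e n)) (a n)) , λ n → trans (sym (e′ n)) (b n))
          e e′ (inj₂ (a , b)) → inj₂ ((λ a′ → a λ n → trans (e n) (a′ n)) , G₀.resp e e′ b)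
      ; functional = λ where
          (inj₁ (_ , b)) (inj₁ (_ , b′)) n → trans (b n) (sym (b′ n))
          (inj₁ (a , _)) (inj₂ (a′ , _)) → contradiction a a′
          (inj₂ (a , _)) (inj₁ (a′ , _)) → contradiction a′ a
          (inj₂ (_ , b)) (inj₂ (_ , b′)) → G₀.functional b b′
      }

    modified-value : ∀ {r q a b} → a ≗ r → modified r q ⟦ a ↦ b ⟧ → b ≗ q
    modified-value e (inj₁ (_ , b)) = b
    modified-value e (inj₂ (a , _)) = contradiction e a

    modified-realizes : ∀ {r q v y} → δ V r v → δ W q y → g ∋ v ↦ y → Realizes (modified r q) g
    modified-realizes {r} {q} {v} {y} dr dq gy a v′ da dm with em {a ≗ r}
    ... | yes e = q , inj₁ (e , λ _ → refl) , y , dq ,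
                  _⇉_.resp g (RepresentedSpace.functional V
                               (δ-resp V (sym ∘ e) (RepresentedSpace.Eq.refl V) dr) da)
                             (RepresentedSpace.Eq.refl W) gy
    ... | no ne = let b , Gb , rest = real₀ a v′ da dm in b , inj₂ (ne , Gb) , rest

module _ {X Y V W S T : RepresentedSpace} {f : X ⇉ Y} {g : V ⇉ W} {h : S ⇉ T} where

  -- The outer part receives only p and the answer of h. It therefore recomputes the intermediate
  -- query by K before it applies H′ and then H.
  ≤W-trans : f ≤W g → g ≤W h → f ≤W h
  ≤W-trans (H , K , (cH , eH) , (cK , eK) , red) (H′ , K′ , (cH′ , eH′) , (cK′ , eK′) , red′) =
    inner , K′ ∘ᵖ K , (cI , inner-computes) ,
    (substᶜ cK cK′ , λ p q (r , Kr , Kq) n → substᶜ-⇓ (eK p r Kr) (eK′ r q Kq n)) ,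
    λ G real p x d dm →
      case red (H′ ∘ᵖ ⟨id, G ∘ᵖ K′ ⟩) (red′ G real) p x d dm of λ where
        (s , (t , (q′ , (k , Kk , (t′ , (q , (k′ , Kk′ , Gq) , t′≗) , Ht′)) , t≗) , Ht) , rest) →
          s , (⟪ p , q ⟫ , (q , (k′ , (k , Kk , Kk′) , Gq) , λ _ → refl) ,
               (k , q′ , K.resp (sym ∘ ⟪⟫-even p q) (λ _ → refl) Kk ,
                H′.resp (λ n → trans (t′≗ n) (⟪⟫-cong (λ _ → refl) (sym ∘ ⟪⟫-odd p q) n))
                        (λ _ → refl) Ht′ ,
                H.resp (λ n → trans (t≗ n) (⟪⟫-cong (sym ∘ ⟪⟫-even p q) (λ _ → refl) n))
                       (λ _ → refl) Ht)) ,
          rest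
    where
    module H = Baire⇀Baire H
    module H′ = Baire⇀Baire H′
    module K = Baire⇀Baire K

    inner : Baire⇀Baire
    inner = record
      { graph = λ r s → ∃₂ λ k q → K ⟦ evens r ↦ k ⟧ × H′ ⟦ ⟪ k , odds r ⟫ ↦ q ⟧ ×
                                   H ⟦ ⟪ evens r , q ⟫ ↦ s ⟧
      ; resp = λ e e′ (k , q , a , b , c) →
          k , q , K.resp (λ n → e (2 * n)) (λ _ → refl) a ,
          H′.resp (⟪⟫-cong (λ _ → refl) λ n → e (suc (2 * n))) (λ _ → refl) b ,
          H.resp (⟪⟫-cong (λ n → e (2 * n)) λ _ → refl) e′ c
      ; functional = λ (k , q , a , b , c) (k′ , q′ , a′ , b′ , c′) →
          H.functional (H.resp (⟪⟫-cong (λ _ → refl)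
            (H′.functional (H′.resp (⟪⟫-cong (K.functional a a′) λ _ → refl) (λ _ → refl) b) b′))
            (λ _ → refl) c) c′
      }

    cE cO cI : Code 1
    cE = code (evensᵗ (x₀ {0}))
    cO = code (oddsᵗ (x₀ {0}))
    cI = substᶜ (↦-join cE (substᶜ (↦-join (substᶜ cE cK) cO) cH′)) cH

    inner-computes : ∀ r s → inner ⟦ r ↦ s ⟧ → r ⊢ cI ↦ s
    inner-computes r s (k , q , a , b , c) n =
      substᶜ-⇓ (↦-join-⇓ even λ n →
        substᶜ-⇓ (↦-join-⇓ (λ n → substᶜ-⇓ even (eK _ _ a n)) λ n → computes (oddsᵗ x₀) r _)
                 (eH′ _ _ b n))
        (eH _ _ c n)
      where
      even : r ⊢ cE ↦ evens r
      even n = computes (evensᵗ x₀) r _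

-- Sequences coded by rows

section : Baire → ℕ → Baire
section p m k = p ⟨ m , k ⟩

rows : (ℕ → Baire) → Baire
rows F c = F (π₁ c) (π₂ c)

rows-section : ∀ F m → section (rows F) m ≗ F m
rows-section F m k = cong₂ F (π₁-pair m k) (π₂-pair m k)

rowsᵗ : ∀ {F : Baire → ℕ → Baire} → Total {2} (λ p v → F p (head v) (head (tailᵛ v))) →
        Total {1} λ p v → rows (F p) (head v)
rowsᵗ t = appᵗ t (app₁ π₁ᵗ x₀ ∷ᵗ app₁ π₂ᵗ x₀ ∷ᵗ []ᵗ)

cons : ℕ → Baire → Baire
cons i p k = ifz k i (p (pred k))

pair-injective : ∀ {i n j m} → ⟨ i , n ⟩ ≡ ⟨ j , m ⟩ → i ≡ j × n ≡ m
pair-injective {i} {n} {j} {m} e =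
  trans (sym (π₁-pair i n)) (trans (cong π₁ e) (π₁-pair j m)) ,
  trans (sym (π₂-pair i n)) (trans (cong π₂ e) (π₂-pair j m))

-- Names in the completion

-- The length grows by at most one per entry, so it skips no number, and it leaves n at a nonzero
-- entry.
length-1-hits : ∀ p {n} k → n < length-1 p k → ∃₂ λ j m → length-1 p j ≡ n × p j ≡ suc m
length-1-hits p (suc k) lt with p k in eq
... | zero  = length-1-hits p k lt
... | suc m with m≤n⇒m<n∨m≡n (≤-pred lt)
...   | inj₁ lt′ = length-1-hits p k lt′
...   | inj₂ e   = k , m , sym e , eq

length-1-injective : ∀ p {k l x y} → p k ≡ suc x → p l ≡ suc y →
                     length-1 p k ≡ length-1 p l → k ≡ l
length-1-injective p {k} {l} a b e with <-cmp k l
... | tri< lt _ _ = contradiction e (<⇒≢ (length-1-< p a lt))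
... | tri≈ _ eq _ = eq
... | tri> _ _ gt = contradiction (sym e) (<⇒≢ (length-1-< p b gt))

-- Zeros are blanks: a name may wait with zeros until a computation halts and then repeat its letter
-- forever.
-1-constant : ∀ {p c} → (∀ t → p t ≡ 0 ⊎ p t ≡ suc c) → Eventually (λ t → p t ≡ suc c) →
              p -1≡ λ _ → c
-- All entries from s on are nonzero, so the first suc n + s entries contribute more than n letters.
-1-constant {p} {c} values (s , h) n with length-1-hits p (suc n + s) (grows (suc n))
  where
  grows : ∀ j → j ≤ length-1 p (j + s)
  grows zero    = z≤n
  grows (suc j) = subst (suc j ≤_) (sym (length-1-suc p (j + s) (h (m≤n+m s j)))) (s≤s (grows j))
... | j , m , e , e′ with values j
...   | inj₁ z  = contradiction (trans (sym z) e′) λ ()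
...   | inj₂ e″ = j , e , e″

suc-1≡ : ∀ q → (suc ∘ q) -1≡ q
suc-1≡ q n = n , length-1-full q n , refl

length-1ᵗ : ∀ {n} {A : Functional (suc n)} {B : Functional n} → Total A → Total B →
            Total λ p v → length-1 (λ x → A p (x ∷ v)) (B p v)
length-1ᵗ {A = A} {B} a b = total-resp (λ p v → lemma (λ x → A p (x ∷ v)) (B p v))
  (iterateᵗ zeroᵗ
    (app₃ ifzᵗ (appᵗ a (x₀ ∷ᵗ tailᵗ (tailᵗ idᵗ))) x₁ (app₁ sucᵗ x₁)) b)
  where
  lemma : ∀ p k → iterate 0 (λ k y → ifz (p k) y (suc y)) k ≡ length-1 p k
  lemma p zero = refl
  lemma p (suc k) with p k
  ... | zero  = lemma p k
  ... | suc _ = cong suc (lemma p k)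

module _ {X Y : RepresentedSpace} {f : X ⇉ Y} where

  Σᵂ-dom : ∀ xs → (∀ n → dom f (xs n)) → dom (Σᵂ f) xs
  Σᵂ-dom xs d = (λ n → just (proj₁ (d n))) , d , 0 , proj₁ (d 0) ,
             RepresentedSpace.Eq.refl (Completion Y) , proj₂ (d 0)

  Σᵂ-elim : ∀ xs ys q → δ (Completion Y ^ℕ) q ys → Σᵂ f ∋ xs ↦ ys →
            ∃ λ n → ∃₂ λ y r → section q n -1≡ r × δ Y r y × f ∋ xs n ↦ y
  Σᵂ-elim xs ys q d (_ , n , y , e , fy) =
    let r , m , dy = δ-resp (Completion Y) {y = just y} (λ _ → refl) e (d n) in n , y , r , m , dy , fy

  -- One correct section suffices: excluded middle decides for every section whether it names a
  -- point or ⊥, so the remaining ones are names in any case.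
  Σᵂ-intro : ExcludedMiddle 0ℓ → ∀ xs q n {r y} → (∀ n → dom f (xs n)) →
             section q n -1≡ r → δ Y r y → f ∋ xs n ↦ y →
             ∃ λ ys → δ (Completion Y ^ℕ) q ys × Σᵂ f ∋ xs ↦ ys
  Σᵂ-intro em xs q n {r} {y} d m dy fy =
    proj₁ ∘ point , proj₂ ∘ point , d , n , y ,
    RepresentedSpace.functional (Completion Y) {y = just y} (proj₂ (point n)) (r , m , dy) , fy
    where
    point : ∀ n → ∃ λ z → δ (Completion Y) (section q n) z
    point n with em {∃ λ r → section q n -1≡ r × ∃ λ y → δ Y r y}
    ... | yes (r , m , y , dy) = just y , r , m , dy
    ... | no none = nothing , none

-- Gödel numberings and the recursion theorem

module Gödel (φ : GödelNumbering) where
  open GödelNumbering φ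

  ≱⇒> : ∀ {i p n k m} → φ[ i , p ] n ⇓ m → φ[ i , p ] n ≱ k → m < k
  ≱⇒> e (inj₁ u) = contradiction (_ , e) u
  ≱⇒> e (inj₂ (m , e′ , lt)) = subst (_< _) (⇓-deterministic e′ e) lt

  -- The translation s is computed with the zero oracle; substituting a program for that oracle
  -- yields one that works under every oracle.
  smnᵗ : ∀ c → ∃ λ s → Total₁ s × (∀ {i p n m} → p ⊢ c · (i ∷ n ∷ []) ⇓ m → φ[ s i , p ] n ⇓ m)
  smnᵗ c with smn c
  ... | s , (d , h) , eq =
    s , total₁ (substᶜ (code (zeroᵗ {1})) d , λ where
      p (x ∷ []) → substᶜ-⇓ (λ _ → computes zeroᵗ p _) (h x)) ,
    λ e → Equivalence.from (eq _ _ _ _) e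

  index : (c : Code 1) → ∃ λ e → ∀ {p n m} → φ[ e , p ] n ⇓ m ⇔ p ⊢ c · (n ∷ []) ⇓ m
  index c with smn (comp c (proj (suc zero) ∷ []))
  ... | s , _ , eq = s 0 , mk⇔
    (λ e → case Equivalence.to (eq _ _ _ _) e of λ where
      (⇓comp (⇓∷ ⇓proj ⇓[]) e) → e)
    (λ e → Equivalence.from (eq _ _ _ _) (⇓comp (⇓∷ ⇓proj ⇓[]) e))

  φ-≤T : ∀ {i p r} → (∀ n → φ[ i , p ] n ⇓ r n) → r ≤T p
  φ-≤T {i} h = comp universal (code (constᵗ i) ∷ proj zero ∷ []) ,
    λ n → ⇓comp (⇓∷ (computes (constᵗ i) _ _) (⇓∷ ⇓proj ⇓[])) (h n)

  -- Here s i is an index of the column n ↦ φ_i(⟨i,n⟩). This self-application yields the recursion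
  -- theorem, and it reserves a separate column for each program in the reduction of `HYP` to
  -- Π(NMAJ).
  padding : ∃ λ s → Total₁ s × (∀ {i p n m} → φ[ i , p ] ⟨ i , n ⟩ ⇓ m → φ[ s i , p ] n ⇓ m)
  padding with smnᵗ (comp universal (proj zero ∷ code (app₂ pairᵗ (x₀ {1}) x₁) ∷ []))
  ... | s , t , h = s , t , λ e → h (⇓comp (⇓∷ ⇓proj (⇓∷ (computes (app₂ pairᵗ x₀ x₁) _ _) ⇓[])) e)

  -- If e is an index of ⟨a,n⟩ ↦ c(s(a),n), then φ_{s(e)}(n) = φ_e(⟨e,n⟩) = c(s(e),n), so s(e) is
  -- the fixed point.
  recursion : ∀ c → ∃ λ i → ∀ {p n m} → p ⊢ c · (i ∷ n ∷ []) ⇓ m → φ[ i , p ] n ⇓ m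
  recursion c with padding
  ... | s , t , h with index (comp c (code (app₁ t (app₁ π₁ᵗ (x₀ {0}))) ∷ code (app₁ π₂ᵗ (x₀ {0})) ∷ []))
  ...   | e , eq = s e , λ {p} {n} {m} d → h (Equivalence.from eq
          (⇓comp (⇓∷ (computes (app₁ t (app₁ π₁ᵗ x₀)) _ _) (⇓∷ (computes (app₁ π₂ᵗ x₀) _ _) ⇓[]))
            (subst₂ (λ i n → p ⊢ c · (i ∷ n ∷ []) ⇓ m)
              (sym (cong s (π₁-pair e n))) (sym (π₂-pair e n)) d)))

  instanceRun : ℕ → Baire → ℕ → ℕ
  instanceRun s p m =
    run universal s (tail (section p m)) (π₁ (p ⟨ m , 0 ⟩) ∷ π₂ (p ⟨ m , 0 ⟩) ∷ [])

  instanceRunᵗ : ∀ (D : Baire → Baire) {n} {S M : Functional n} → Total {1} (λ p v → D p (head v)) →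
                 Total S → Total M → Total λ p v → instanceRun (S p v) (D p) (M p v)
  instanceRunᵗ D {M = M} d s m =
    runᵗ universal {A = λ p v → D p ⟨ M p (tailᵛ v) , suc (head v) ⟩} s
      (appᵗ d (app₂ pairᵗ (weakenᵗ m) (app₁ sucᵗ x₀) ∷ᵗ []ᵗ))
      (app₁ π₁ᵗ top ∷ᵗ app₁ π₂ᵗ top ∷ᵗ []ᵗ)
    where top = appᵗ d (app₂ pairᵗ m zeroᵗ ∷ᵗ []ᵗ)

  instanceRun-cong : ∀ {p q} s m → p ≗ q → instanceRun s p m ≡ instanceRun s q m
  instanceRun-cong s m = total-cong (instanceRunᵗ id (oracleᵗ x₀) x₀ x₁) (s ∷ m ∷ [])

  -- The value at a is the first b found such that instance ⟨a,b⟩ is defined.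
  definedInstance : Functional 2
  definedInstance p v =
    ifz (instanceRun (π₂ (head v)) (odds p) ⟨ head (tailᵛ v) , π₁ (head v) ⟩) 0 (suc (π₁ (head v)))

  definedInstanceᵗ : Total definedInstance
  definedInstanceᵗ = app₃ ifzᵗ
    (instanceRunᵗ odds (oddsᵗ x₀) (app₁ π₂ᵗ x₀) (app₂ pairᵗ x₁ (app₁ π₁ᵗ x₀)))
    zeroᵗ (app₁ sucᵗ (app₁ π₁ᵗ x₀))

  definedInstance-nonzero : ∀ p a b s {y} → instanceRun s (odds p) ⟨ a , b ⟩ ≡ suc y →
                            definedInstance p (⟨ b , s ⟩ ∷ a ∷ []) ≢ 0
  definedInstance-nonzero p a b s e =
    subst₂ (λ b s → ifz (instanceRun s (odds p) ⟨ a , b ⟩) 0 (suc b) ≢ 0)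
      (sym (π₁-pair b s)) (sym (π₂-pair b s))
      (λ e₀ → contradiction (trans (sym (cong (λ n → ifz n 0 (suc b)) e)) e₀) λ ())

  DISRun : ℕ → Baire → ℕ → ℕ
  DISRun s x n = run universal s ⟪ tail (evens x) , odds x ⟫ (x 0 ∷ n ∷ [])

  DISRunᵗ : ∀ {n} {S N : Functional n} → Total S → Total N →
            Total λ x v → DISRun (S x v) x (N x v)
  DISRunᵗ s n = runᵗ universal s
    (⟪⟫ᵗ {A = λ x v → tail (evens x) (head v)} {B = λ x v → odds x (head v)}
       (evensᵗ (app₁ sucᵗ x₀)) (oddsᵗ x₀))
    (oracleᵗ zeroᵗ ∷ᵗ n ∷ᵗ []ᵗ)

  -- The search variable codes a time bound and a position t in row ⟨m,n⟩ of the value of U. The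
  -- predecessor identifies an unfinished evaluation with the entry 0, so the search finds a nonzero
  -- entry and returns it minus one.
  firstEntry : Functional 3
  firstEntry x v =
    pred (DISRun (π₁ (head v)) x ⟨ ⟨ head (tailᵛ v) , head (tailᵛ (tailᵛ v)) ⟩ , π₂ (head v) ⟩)

  firstEntryᵗ : Total firstEntry
  firstEntryᵗ = app₁ predᵗ (DISRunᵗ (app₁ π₁ᵗ x₀) (app₂ pairᵗ (app₂ pairᵗ x₁ x₂) (app₁ π₂ᵗ x₀)))

  module Classical (em : ExcludedMiddle 0ℓ) where

    φ-bound : ∀ i p n → ∃ λ k → φ[ i , p ] n ≱ k
    φ-bound i p n with em {∃ λ m → φ[ i , p ] n ⇓ m}
    ... | yes (m , e) = suc m , inj₂ (m , e , ≤-refl)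
    ... | no u        = 0 , inj₁ u

    NGEQ-total : ∀ x → dom (NGEQ φ) x
    NGEQ-total x with φ-bound (π₁ (x 0)) (tail x) (π₂ (x 0))
    ... | k , h = k , π₁ (x 0) , π₂ (x 0) , sym (pair-unpair (x 0)) , h

    NMAJ-total : ∀ x → dom (NMAJ φ) x
    NMAJ-total x with φ-bound (x 0) (tail x) 0
    ... | k , h = (λ _ → k) , 0 , h

    -- U has at most one value, so one of two distinct constants is always admissible.
    DIS-total : ∀ x → dom (DIS φ) x
    DIS-total x with em {U[_]⇓_ φ x (λ _ → 0)}
    ... | no ¬u = (λ _ → 0) , ¬u
    ... | yes u = (λ _ → 1) , λ u′ → contradiction (⇓-deterministic (u 0) (u′ 0)) λ ()

    -- The problems Σ(NMAJ), Σ(NGEQ) and DIS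

    ΣNMAJ≤ΣNGEQ : Σᵂ (NMAJ φ) ≤W Σᵂ (NGEQ φ)
    ΣNMAJ≤ΣNGEQ = ≤W-by {f = Σᵂ (NMAJ φ)} {g = Σᵂ (NGEQ φ)} (λ p → rows (row p)) (λ _ q → q)
      (rowsᵗ {row} (app₃ ifzᵗ x₁ (app₂ pairᵗ (oracleᵗ (app₂ pairᵗ x₀ zeroᵗ)) zeroᵗ)
                           (oracleᵗ (app₂ pairᵗ x₀ (app₁ sucᵗ (app₁ predᵗ x₁))))))
      (oddsᵗ x₀)
      (λ {p} _ _ → row p , rows-section (row p) , Σᵂ-dom {f = NGEQ φ} (row p) λ m → NGEQ-total (row p m))
      λ {p} {xs} {v} {q} {ys} d _ dv dq s →
        let m , k , r , r≡ , e , i , n , v≡ , h = Σᵂ-elim {f = NGEQ φ} v ys q dq s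
            v≗ : ∀ k → v m k ≡ row p m k
            v≗ = λ k → trans (sym (dv m k)) (rows-section (row p) m k)
            i≡ , n≡ = pair-injective (trans (sym v≡) (v≗ 0))
        in Σᵂ-intro {f = NMAJ φ} em xs q m (NMAJ-total ∘ xs) r≡ (λ _ → refl)
             -- Each instance is queried at the argument 0 only. The name r of the bound k has r 0 =
             -- k, so r itself is a solution.
             (0 , subst (λ n → φ[ xs m 0 , tail (xs m) ] n ≱ r 0) n≡
                    (≱-resp {q = tail (xs m)} (trans i≡ (d m 0)) (λ k → trans (v≗ (suc k)) (d m (suc k))) (sym e) h))
      where
      row : Baire → ℕ → Baire
      row p m = cons ⟨ p ⟨ m , 0 ⟩ , 0 ⟩ (tail (section p m))

    -- Only the instance with number 0 is solved; its answer, shifted into the completion, fills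
    -- every section.
    ΣNMAJ≤NMAJ : Σᵂ (NMAJ φ) ≤W NMAJ φ
    ΣNMAJ≤NMAJ = ≤W-by {f = Σᵂ (NMAJ φ)} {g = NMAJ φ} (λ p → section p 0) (λ _ q → rows (λ _ → suc ∘ q))
      (oracleᵗ (app₂ pairᵗ zeroᵗ x₀))
      (app₁ sucᵗ (oddsᵗ (app₁ π₂ᵗ x₀)))
      (λ {p} _ _ → section p 0 , (λ _ → refl) , NMAJ-total (section p 0))
      λ {p} {xs} {v} {q} {y} d _ dv dq s →
        Σᵂ-intro {f = NMAJ φ} em xs (rows λ _ → suc ∘ q) 0 (NMAJ-total ∘ xs)
          (-1-resp (sym ∘ rows-section (λ _ → suc ∘ q) 0) (suc-1≡ q)) dq
          (_⇉_.resp (NMAJ φ) {y = y} (λ k → trans (sym (dv k)) (d 0 k)) (λ _ → refl) s)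

    ΣNGEQ≤DIS : Σᵂ (NGEQ φ) ≤W DIS φ
    ΣNGEQ≤DIS = ≤W-by {f = Σᵂ (NGEQ φ)} {g = DIS φ} K (λ p q → rows (row p q))
      (⟪⟫ᵗ {A = λ _ v → cons e (λ _ → 0) (head v)} {B = λ p v → p (head v)}
        (app₃ ifzᵗ x₀ (constᵗ e) zeroᵗ) (oracleᵗ x₀))
      (rowsᵗ {λ r → row (evens r) (odds r)}
        (app₃ ifzᵗ (app₂ distanceᵗ (oddsᵗ (app₁ π₁ᵗ x₀)) (app₁ π₂ᵗ x₀)) (constᵗ 1)
          (app₃ ifzᵗ run′ zeroᵗ (app₁ sucᵗ run′))))
      (λ {p} _ _ → K p , (λ _ → refl) , DIS-total (K p))
      λ {p} {xs} {v} {q} {y} d _ dv dq ¬u → answer p xs q d λ u →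
        ¬u (U-resp φ dv dq u)
      where
      e = proj₁ (index (searchᶜ definedInstanceᵗ))
      eq : ∀ {p n m} → φ[ e , p ] n ⇓ m ⇔ p ⊢ searchᶜ definedInstanceᵗ · (n ∷ []) ⇓ m
      eq = proj₂ (index (searchᶜ definedInstanceᵗ))

      -- On this query U is φ_e relative to the join of the zero sequence with p, so
      -- `definedInstance` finds p at the odd entries.
      K : Baire → Baire
      K p = ⟪ cons e (λ _ → 0) , p ⟫

      -- A constant 1 names the number 0. Otherwise the row stays blank until the instance has a
      -- value z and then repeats z + 2, which names the bound z + 1.
      row : Baire → Baire → ℕ → Baire
      row p q m t = ifz (distance (q (π₁ m)) (π₂ m)) 1
                        (ifz (instanceRun t p m) 0 (suc (instanceRun t p m)))

      run′ : Total {2} λ r v → instanceRun (head (tailᵛ v)) (evens r) (head v)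
      run′ = instanceRunᵗ evens (evensᵗ x₀) x₁ x₀

      answer : ∀ p xs q → (∀ m k → p ⟨ m , k ⟩ ≡ xs m k) → ¬ U[_]⇓_ φ (K p) q →
               ∃ λ ys → δ (Completion ℕᴿ ^ℕ) (rows (row p q)) ys × Σᵂ (NGEQ φ) ∋ xs ↦ ys
      answer p xs q d ¬u =
        case em {∃ λ m → ∃ λ k → section (rows (row p q)) m -1≡ (λ _ → k) × NGEQ φ ∋ xs m ↦ k} of λ where
          (yes (m , k , name , h)) →
            Σᵂ-intro {f = NGEQ φ} em xs (rows (row p q)) m (NGEQ-total ∘ xs) name refl h
          (no none) → contradiction (U⇓q p xs q d none) ¬u
        where
        module _ (p : Baire) (xs : ℕ → Baire) (q : Baire) (d : ∀ m k → p ⟨ m , k ⟩ ≡ xs m k)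
          (none : ¬ ∃ λ m → ∃ λ k → section (rows (row p q)) m -1≡ (λ _ → k) × NGEQ φ ∋ xs m ↦ k)
          where
          Ψ : ℕ → ℕ → Set
          Ψ m z = φ[ π₁ (p ⟨ m , 0 ⟩) , tail (section p m) ] π₂ (p ⟨ m , 0 ⟩) ⇓ z

          solved : ∀ {m k} → φ[ π₁ (p ⟨ m , 0 ⟩) , tail (section p m) ] π₂ (p ⟨ m , 0 ⟩) ≱ k →
                   NGEQ φ ∋ xs m ↦ k
          solved {m} h = _ , _ , trans (sym (d m 0)) (sym (pair-unpair _)) ,
                         ≱-resp refl (λ k → d m (suc k)) refl h

          row-at : ∀ a b {n} t → distance (q a) b ≡ n → section (rows (row p q)) ⟨ a , b ⟩ t ≡
                   ifz n 1 (ifz (instanceRun t p ⟨ a , b ⟩) 0 (suc (instanceRun t p ⟨ a , b ⟩)))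
          row-at a b t e = trans (rows-section (row p q) ⟨ a , b ⟩ t)
            (cong (λ n → ifz n 1 (ifz (instanceRun t p ⟨ a , b ⟩) 0 (suc (instanceRun t p ⟨ a , b ⟩))))
              (trans (cong₂ distance (cong q (π₁-pair a b)) (π₂-pair a b)) e))

          constant-row : ∀ a → section (rows (row p q)) ⟨ a , q a ⟩ -1≡ λ _ → 0
          constant-row a = -1-constant (λ t → inj₂ (row-at a (q a) t (distance-refl (q a))))
                                       (0 , λ {t} _ → row-at a (q a) t (distance-refl (q a)))

          defined : ∀ a → ∃ λ z → Ψ ⟨ a , q a ⟩ z
          defined a = case em {∃ λ z → Ψ ⟨ a , q a ⟩ z} of λ where
            (yes h) → h
            (no h)  → contradiction (⟨ a , q a ⟩ , 0 , constant-row a , solved (inj₁ h)) none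

          -- If q(a) differed from b, the row of ⟨a,b⟩ would wait for the value z and then name the
          -- correct answer z + 1.
          unique : ∀ a b z → Ψ ⟨ a , b ⟩ z → q a ≡ b
          unique a b z h = case q a ≟ b of λ where
            (yes e) → e
            (no ne) →
              let m      = ⟨ a , b ⟩
                  _ , eq = distance-≢ ne
              in contradiction
                (m , suc z ,
                 -1-constant
                   (λ t → subst (λ n → n ≡ 0 ⊎ n ≡ 2+ z) (sym (row-at a b t eq))
                     (ifz-values (instanceRun t p m)
                       λ e → ⇓-deterministic (run-sound universal _ e) h))
                   (eventually-map (λ t e → trans (row-at a b t eq) (cong (λ n → ifz n 0 (suc n)) e))
                                   (run-complete h)) ,
                 solved (inj₂ (z , h , ≤-refl)))
                none

          oracle′ : Baire
          oracle′ = ⟪ tail (evens (K p)) , odds (K p) ⟫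

          oracle′-odds : odds oracle′ ≗ p
          oracle′-odds n = trans (⟪⟫-odd (tail (evens (K p))) (odds (K p)) n) (⟪⟫-odd (cons e λ _ → 0) p n)

          U⇓q : U[_]⇓_ φ (K p) q
          U⇓q a =
            let z , h           = defined a
                s , eventually  = run-complete h
                t , b , found , d = search-⇓ definedInstanceᵗ {oracle′} {a ∷ []} {⟨ q a , s ⟩}
                  (definedInstance-nonzero oracle′ a (q a) s
                    (trans (instanceRun-cong s ⟨ a , q a ⟩ oracle′-odds) (eventually ≤-refl)))
                y , e , b≡ = ifz-suc (instanceRun (π₂ t) (odds oracle′) ⟨ a , π₁ t ⟩) found
            in Equivalence.from eq (subst (oracle′ ⊢ searchᶜ definedInstanceᵗ · (a ∷ []) ⇓_)
                 (trans (sym b≡) (sym (unique a (π₁ t) y (run-sound universal _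
                   (trans (sym (instanceRun-cong (π₂ t) ⟨ a , π₁ t ⟩ oracle′-odds)) e))))) d)

    -- If U had the value H q, the m-th instance would compute exactly the m-th answer r, so r would
    -- not exceed it anywhere, although r solves it.
    DIS≤ΣNMAJ : DIS φ ≤W Σᵂ (NMAJ φ)
    DIS≤ΣNMAJ = ≤W-by {f = DIS φ} {g = Σᵂ (NMAJ φ)} (λ x → rows (λ m → cons (s m) x)) (λ _ → H)
      (rowsᵗ {λ x m → cons (s m) x} (app₃ ifzᵗ x₁ (app₁ sᵗ x₀) (oracleᵗ (app₁ predᵗ x₁))))
      (rowsᵗ {λ r → row (odds r)}
        (app₃ ifzᵗ (app₂ distanceᵗ
                     (length-1ᵗ {A = λ r v → section (odds r) (π₁ (head (tailᵛ v))) (head v)}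
                                (oddsᵗ (app₂ pairᵗ (app₁ π₁ᵗ x₁) x₀)) x₁)
                     (app₁ π₂ᵗ x₀))
                   (oddsᵗ (app₂ pairᵗ (app₁ π₁ᵗ x₀) x₁)) zeroᵗ))
      (λ {p} _ _ → (λ m → cons (s m) p) , rows-section (λ m → cons (s m) p) ,
                   Σᵂ-dom {f = NMAJ φ} (λ m → cons (s m) p) λ m → NMAJ-total (cons (s m) p))
      λ {p} {x} {v} {q} {ys} d _ dv dq h →
        let m , y , r , r≡ , ry , n , ≱ = Σᵂ-elim {f = NMAJ φ} v ys q dq h
            v≗ : v m ≗ cons (s m) p
            v≗ = λ k → trans (sym (dv m k)) (rows-section (λ m → cons (s m) p) m k)
        in H q , (λ _ → refl) , λ u →
          contradiction (≱⇒> (majorant p q (U-resp φ (sym ∘ d) (λ _ → refl) u) m r≡ n)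
                             (≱-resp (v≗ 0) (λ k → v≗ (suc k)) (sym (ry n)) ≱))
                        (<-irrefl refl)
      where
      s : ℕ → ℕ
      s = proj₁ (smnᵗ (searchᶜ firstEntryᵗ))

      sᵗ : Total₁ s
      sᵗ = proj₁ (proj₂ (smnᵗ (searchᶜ firstEntryᵗ)))

      s-φ : ∀ {i p n m} → p ⊢ searchᶜ firstEntryᵗ · (i ∷ n ∷ []) ⇓ m → φ[ s i , p ] n ⇓ m
      s-φ = proj₂ (proj₂ (smnᵗ (searchᶜ firstEntryᵗ)))

      -- Giving every letter of row m of q a row of its own lets a search for a
      -- nonzero entry recover that letter.
      row : Baire → ℕ → Baire
      row q c t = ifz (distance (length-1 (section q (π₁ c)) t) (π₂ c)) (q ⟨ π₁ c , t ⟩) 0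

      H : Baire → Baire
      H q = rows (row q)

      H-at : ∀ q m n t → H q ⟨ ⟨ m , n ⟩ , t ⟩ ≡
             ifz (distance (length-1 (section q m) t) n) (q ⟨ m , t ⟩) 0
      H-at q m n t = trans (rows-section (row q) ⟨ m , n ⟩ t)
        (cong₂ (λ m n → ifz (distance (length-1 (section q m) t) n) (q ⟨ m , t ⟩) 0)
               (π₁-pair m n) (π₂-pair m n))

      -- Row ⟨m,n⟩ of H q is nonzero at one position only, that of the n-th letter of section m.
      -- Whichever position the search finds is therefore this one, and its entry is r n + 1.
      majorant : ∀ p q → U[_]⇓_ φ p (H q) → ∀ m {r} → section q m -1≡ r → ∀ n →
                 φ[ s m , p ] n ⇓ r n
      majorant p q u m {r} r≡ n =
        let t , length≡ , q≡ = r≡ n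
            H≡ : H q ⟨ c , t ⟩ ≡ suc (r n)
            H≡ = trans (H-at q m n t) (trans (cong (λ d → ifz d (q ⟨ m , t ⟩) 0)
                   (trans (cong (λ l → distance l n) length≡) (distance-refl n))) q≡)
            s₀ , eventually = run-complete (u ⟨ c , t ⟩)
            w , z , found , e = search-⇓ firstEntryᵗ {p} {m ∷ n ∷ []} {⟨ s₀ , t ⟩}
              (subst₂ (λ s t → pred (DISRun s p ⟨ c , t ⟩) ≢ 0)
                (sym (π₁-pair s₀ t)) (sym (π₂-pair s₀ t))
                (subst (_≢ 0) (sym (cong pred (trans (eventually ≤-refl) (cong suc H≡)))) λ ()))
            t′ = π₂ w
            H≡′ : H q ⟨ c , t′ ⟩ ≡ suc z
            H≡′ = ⇓-deterministic (u ⟨ c , t′ ⟩) (run-sound universal _ (pred-suc _ found))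
            d≡ , q≡′ = ifz-entry (distance (length-1 (section q m) t′) n)
                         (trans (sym (H-at q m n t′)) H≡′)
            t≡ : t′ ≡ t
            t≡ = length-1-injective (section q m) q≡′ q≡
                   (trans (distance≡0⇒≡ _ n d≡) (sym length≡))
        in s-φ (subst (p ⊢ searchᶜ firstEntryᵗ · (m ∷ n ∷ []) ⇓_)
             (suc-injective (trans (sym H≡′) (trans (cong (λ t → H q ⟨ c , t ⟩) t≡) H≡))) e)
        where
        c = ⟨ m , n ⟩
        pred-suc : ∀ k {z} → pred k ≡ suc z → k ≡ 2+ z
        pred-suc (suc k) e = cong suc e
        ifz-entry : ∀ d {x z} → ifz d x 0 ≡ suc z → d ≡ 0 × x ≡ suc z
        ifz-entry zero e = refl , e

    -- Solutions and realizers of the problems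

    undefined-or-total : ∀ i p → (∃ λ n → ¬ ∃ λ m → φ[ i , p ] n ⇓ m) ⊎
                                 (∃ λ r → ∀ n → φ[ i , p ] n ⇓ r n)
    undefined-or-total i p = case em {∃ λ n → ¬ ∃ λ m → φ[ i , p ] n ⇓ m} of λ where
      (yes h) → inj₁ h
      (no h)  → let value = λ n → decidable-stable em (λ u → h (n , u)) in
                inj₂ (proj₁ ∘ value , proj₂ ∘ value)

    HYP⇒≱ : ∀ {i p p′ q} → p′ ≤T p → HYP ∋ p ↦ q → ∃ λ n → φ[ i , p′ ] n ≱ q n
    HYP⇒≱ {i} {p} {p′} le h = case undefined-or-total i p′ of λ where
      (inj₁ (n , u)) → n , inj₁ u
      (inj₂ (r , e)) → let n , lt = h r (≤T-trans (φ-≤T e) le) in n , inj₂ (r n , e n , lt)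

    -- A realizer by q(n) = φ(n) + 1 where φ(n) is defined, and q(n) = 0 elsewhere.
    module Successor (i : Baire → ℕ → ℕ) (o : Baire → Baire)
      (i-resp : ∀ {p q} → p ≗ q → ∀ n → i p n ≡ i q n)
      (o-resp : ∀ {p q} → p ≗ q → o p ≗ o q) where

      R : Baire → ℕ → ℕ → Set
      R p n m = φ[ i p n , o p ] n ⇓ m

      R-resp : ∀ {p q n m} → p ≗ q → R p n m → R q n m
      R-resp {q = q} {n} {m} e h =
        subst (λ j → φ[ j , o q ] n ⇓ m) (i-resp e n) (⇓-resp (o-resp e) h)

      Value : Baire → ℕ → ℕ → Set
      Value p n k = (∃ λ m → R p n m × k ≡ suc m) ⊎ (¬ (∃ λ m → R p n m) × k ≡ 0)

      value-resp : ∀ {p q n k} → p ≗ q → Value p n k → Value q n k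
      value-resp e (inj₁ (m , h , k≡)) = inj₁ (m , R-resp e h , k≡)
      value-resp e (inj₂ (u , k≡))     = inj₂ ((λ (m , h) → u (m , R-resp (sym ∘ e) h)) , k≡)

      value-functional : ∀ {p n k l} → Value p n k → Value p n l → k ≡ l
      value-functional (inj₁ (m , h , refl)) (inj₁ (m′ , h′ , refl)) = cong suc (⇓-deterministic h h′)
      value-functional (inj₁ (m , h , _)) (inj₂ (u , _)) = contradiction (m , h) u
      value-functional (inj₂ (u , _)) (inj₁ (m , h , _)) = contradiction (m , h) u
      value-functional (inj₂ (_ , refl)) (inj₂ (_ , refl)) = refl

      realizer : Baire⇀Baire
      realizer = record
        { graph      = λ p q → ∀ n → Value p n (q n)
        ; resp       = λ {p} {p′} e f h n → subst (Value p′ n) (f n) (value-resp e (h n))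
        ; functional = λ h h′ n → value-functional (h n) (h′ n)
        }

      value : ∀ p n → ∃ λ k → Value p n k
      value p n = case em {∃ λ m → R p n m} of λ where
        (yes (m , h)) → suc m , inj₁ (m , h , refl)
        (no u)        → 0 , inj₂ (u , refl)

      value->  : ∀ {p n m k} → Value p n k → R p n m → m < k
      value-> (inj₁ (m , h , refl)) h′ = s≤s (≤-reflexive (⇓-deterministic h′ h))
      value-> (inj₂ (u , _))        h′ = contradiction (_ , h′) u

      realizes : ∀ {f : ℕ^ℕ ⇉ ℕ^ℕ} → (∀ {p q} → (∀ n → Value p n (q n)) → f ∋ p ↦ q) →
                 ∃ λ G → Realizes G f
      realizes {f} h = realizer , λ p x d _ →
        let q = λ n → proj₁ (value p n)
            v = λ n → proj₂ (value p n) in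
        q , v , q , (λ _ → refl) , _⇉_.resp f d (λ _ → refl) (h {p} {q} v)

    module Diagonal = Successor (λ _ n → n) id (λ _ _ → refl) id

    -- A function computable from p has an index e, and it is exceeded by the diagonal solution at
    -- the argument e.
    diagonal-HYP : ∀ {p q} → (∀ n → Diagonal.Value p n (q n)) → HYP ∋ p ↦ q
    diagonal-HYP v r (c , h) =
      let e , eq = index c in e , Diagonal.value-> (v e) (Equivalence.from eq (h e))

    HYP-total : ∀ p → dom HYP p
    HYP-total p = (λ n → proj₁ (Diagonal.value p n)) , diagonal-HYP λ n → proj₂ (Diagonal.value p n)

    HYP⇒NON : ∀ {p q} → HYP ∋ p ↦ q → NON ∋ p ↦ q
    HYP⇒NON h le = let n , lt = h _ le in <-irrefl refl lt

    NON-realizer : ∃ λ G → Realizes G NON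
    NON-realizer = Diagonal.realizes {NON} λ v → HYP⇒NON (diagonal-HYP v)

    NMAJ-realizer : ∃ λ G → Realizes G (NMAJ φ)
    NMAJ-realizer = S.realizes {NMAJ φ} λ {p} {q} v → 0 , bound {p} {q} (v 0)
      where
      module S = Successor (λ x _ → x 0) tail (λ e _ → e 0) (λ e → e ∘ suc)
      bound : ∀ {p q} → S.Value p 0 (q 0) → φ[ p 0 , tail p ] 0 ≱ q 0
      bound (inj₁ (m , h , e)) = inj₂ (m , h , ≤-reflexive (sym e))
      bound (inj₂ (u , _))     = inj₁ u

    DIS-realizer : ∃ λ G → Realizes G (DIS φ)
    DIS-realizer = S.realizes {DIS φ} λ {p} v u → <-irrefl refl (S.value-> {p} (v 0) (u 0))
      where
      module S = Successor (λ x _ → x 0) (λ x → ⟪ tail (evens x) , odds x ⟫) (λ e _ → e 0)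
        (λ e → ⟪⟫-cong (λ n → e (2 * suc n)) (λ n → e (suc (2 * n))))

    -- Reductions to and from HYP

    -- All instances are computable from the one name p, so a single solution q for p solves each of
    -- them and is copied into every row.
    ΠNMAJ≤HYP : Πᵂ (NMAJ φ) ≤sW HYP
    ΠNMAJ≤HYP = ≤sW-by {f = Πᵂ (NMAJ φ)} {g = HYP} id (λ q → rows (λ _ → q))
      (oracleᵗ x₀) (oracleᵗ (app₁ π₂ᵗ x₀))
      (λ {p} _ _ → p , (λ _ → refl) , HYP-total p)
      λ {p} {xs} {v} {q} {y} d _ dv dq h →
        (λ _ → q) , rows-section (λ _ → q) ,
        λ m → HYP⇒≱ {i = xs m 0} {q = q}
          (≤T-trans (≤T-reflexive (λ k → sym (d m (suc k))))
                    (≤T-total (oracleᵗ (app₂ pairᵗ (constᵗ m) (app₁ sucᵗ x₀))) p))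
          (_⇉_.resp HYP (sym ∘ dv) (sym ∘ dq) h)

    -- The e-th instance is the column n ↦ φ_e(⟨e,n⟩), and row e of the answer sits at the same
    -- positions ⟨e,n⟩. The name of the sequence of answers thus is a solution without any decoding.
    HYP≤ΠNMAJ : HYP ≤sW Πᵂ (NMAJ φ)
    HYP≤ΠNMAJ = ≤sW-by {f = HYP} {g = Πᵂ (NMAJ φ)} (λ p → rows (λ m → cons (s m) p)) id
      (rowsᵗ {λ p m → cons (s m) p} (app₃ ifzᵗ x₁ (app₁ (proj₁ (proj₂ padding)) x₀)
                                            (oracleᵗ (app₁ predᵗ x₁))))
      (oracleᵗ x₀)
      (λ {p} _ _ → (λ m → cons (s m) p) , rows-section (λ m → cons (s m) p) ,
        let dom-row = λ m → NMAJ-total (cons (s m) p) in proj₁ ∘ dom-row , proj₂ ∘ dom-row)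
      λ {p} {x} {v} {q} {y} d _ dv dq h → q , (λ _ → refl) , λ r le →
        let c , computes-r = ≤T-trans le (≤T-reflexive (sym ∘ d))
            e , eq         = index c
            n , ≱          = h e
            v≗             = λ k → trans (sym (dv e k)) (rows-section (λ m → cons (s m) p) e k)
        in ⟨ e , n ⟩ , subst (r ⟨ e , n ⟩ <_) (sym (dq e n))
             (≱⇒> (proj₂ (proj₂ padding) (Equivalence.from eq (computes-r ⟨ e , n ⟩)))
                  (≱-resp (v≗ 0) (λ k → v≗ (suc k)) refl ≱))
      where
      s : ℕ → ℕ
      s = proj₁ padding

    NMAJ≤HYP : NMAJ φ ≤W HYP
    NMAJ≤HYP = ≤W-by {f = NMAJ φ} {g = HYP} id (λ _ q → q) (oracleᵗ x₀) (oddsᵗ x₀)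
      (λ {p} _ _ → p , (λ _ → refl) , HYP-total p)
      λ {p} {x} {v} {q} {y} d _ dv dq h → q , (λ _ → refl) ,
        HYP⇒≱ {i = x 0} {q = q} (≤T-trans (≤T-total (oracleᵗ (app₁ sucᵗ x₀)) x) (≤T-reflexive (sym ∘ d)))
                                (_⇉_.resp HYP (sym ∘ dv) (sym ∘ dq) h)

    HYP^𝒟-total : ∀ p → dom (HYP ^𝒟) p
    HYP^𝒟-total p = let y , h = HYP-total p in
      y , y , ≡T-reflexive (λ _ → refl) , y , (y , (λ _ → refl) , ≤T-reflexive λ _ → refl) , h

    -- Any name of the degree computes a solution of `HYP`, which is not computable from p; hence
    -- neither is the name.
    NON≤HYP^𝒟 : NON ≤W HYP ^𝒟
    NON≤HYP^𝒟 = ≤W-by {f = NON} {g = HYP ^𝒟} id (λ _ q → q) (oracleᵗ x₀) (oddsᵗ x₀)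
      (λ {p} _ _ → p , (λ _ → refl) , HYP^𝒟-total p)
      λ {p} {x} {v} {q} {y} d _ dv dq (q′ , y≡ , z , (z′ , dz , z′≤) , h) →
        q , (λ _ → refl) , λ le → HYP⇒NON h
          (≤T-trans (≤T-reflexive (sym ∘ dz)) (≤T-trans z′≤ (≤T-trans (proj₂ y≡)
            (≤T-trans (proj₂ dq) (≤T-trans le (≤T-reflexive λ n → trans (sym (d n)) (dv n)))))))

    -- HYP is not reducible to NMAJ

    zeros : Baire
    zeros _ = 0

    ⟪⟫-≤T : ∀ {p q r} → p ≤T r → q ≤T r → ⟪ p , q ⟫ ≤T r
    ⟪⟫-≤T (c , h) (d , k) = ↦-join c d , ↦-join-⇓ h k

    -- A non-uniform choice: zero works if the function is undefined somewhere, and otherwise the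
    -- function plus one is computable from x.
    NMAJ-computable-solution : ∀ x → ∃ λ q → NMAJ φ ∋ x ↦ q × q ≤T x
    NMAJ-computable-solution x = case undefined-or-total (x 0) (tail x) of λ where
      (inj₁ (n , u)) → zeros , (n , inj₁ u) , ≤T-total zeroᵗ x
      (inj₂ (r , e)) → suc ∘ r , (0 , inj₂ (r 0 , e 0 , ≤-refl)) ,
        ≤T-trans (≤T-total (app₁ sucᵗ (oracleᵗ x₀)) r)
                 (≤T-trans (φ-≤T e) (≤T-total (oracleᵗ (app₁ sucᵗ x₀)) x))

    HYP≰NMAJ : ¬ (HYP ≤W NMAJ φ)
    HYP≰NMAJ red with ≤W-answers {f = HYP} {g = NMAJ φ} em NMAJ-realizer red
    ... | h , k , answers =
      let r , Kr , solve  = answers zeros zeros (λ _ → refl) (HYP-total zeros)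
          q , maj , q≤    = NMAJ-computable-solution r
          s , z , Hs , dz , hyp = solve r q q (λ _ → refl) (λ _ → refl) maj
      in HYP⇒NON (_⇉_.resp HYP (λ _ → refl) (sym ∘ dz) hyp)
           (≤T-trans (h , Hs) (⟪⟫-≤T (≤T-reflexive λ _ → refl) (≤T-trans q≤ (k , Kr))))

    -- NMAJ is not reducible to DIS

    module _ (h k : Code 1) where

      answerRun : ℕ → ℕ → ℕ → ℕ → ℕ
      answerRun j s i n = run h s ⟪ cons i zeros , (λ _ → j) ⟫ (n ∷ [])

      -- The value at 0 of U on the query computed by k.
      queryCode : Code 1
      queryCode = substᶜ k (comp
        (substᶜ (code (⟪⟫ᵗ {0} {λ x v → tail (evens x) (head v)} {λ x v → odds x (head v)}
                         (evensᵗ (app₁ sucᵗ x₀)) (oddsᵗ x₀)))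
                universal)
        (code (oracleᵗ (zeroᵗ {1})) ∷ proj zero ∷ []))

      queryRun : ℕ → ℕ → ℕ
      queryRun s i = run queryCode s (cons i zeros) (0 ∷ [])

      -- The arguments are results of `run`, hence shifted by one. Any positive value of U at 0, not
      -- only 1, makes 000... admissible, and then 111... need not be awaited.
      is-zero is-positive : ℕ → ℕ
      is-zero v     = ifz v 0 (ifz (pred v) 1 0)
      is-positive v = pred v

      -- A nonzero factor means that the corresponding constant answer is
      -- evaluated, or that it is the value of U and hence inadmissible.
      bothAnswered : ℕ → ℕ → ℕ → ℕ
      bothAnswered s i n = (answerRun 0 s i n + is-zero (queryRun s i)) *
                           (answerRun 1 s i n + is-positive (queryRun s i))

      majorant : Functional 3
      majorant _ v = let s = head v ; i = head (tailᵛ v) ; n = head (tailᵛ (tailᵛ v)) in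
        -- The search returns the sum. A nonzero summand is one more than the answer it evaluates,
        -- so the sum is strictly larger than that answer.
        ifz (bothAnswered s i n) 0 (suc (answerRun 0 s i n + answerRun 1 s i n))

      majorantᵗ : Total majorant
      majorantᵗ = app₃ ifzᵗ
        (app₂ *ᵗ (app₂ +ᵗ (answerᵗ 0) (app₃ ifzᵗ queryᵗ zeroᵗ
                                        (app₃ ifzᵗ (app₁ predᵗ queryᵗ) (constᵗ 1) zeroᵗ)))
                 (app₂ +ᵗ (answerᵗ 1) (app₁ predᵗ queryᵗ)))
        zeroᵗ (app₁ sucᵗ (app₂ +ᵗ (answerᵗ 0) (answerᵗ 1)))
        where
        consᵗ : Total {4} λ _ v → cons (head (tailᵛ (tailᵛ v))) zeros (head v)
        consᵗ = app₃ ifzᵗ x₀ x₂ zeroᵗ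
        answerᵗ : ∀ j → Total {3} λ _ v → answerRun j (head v) (head (tailᵛ v)) (head (tailᵛ (tailᵛ v)))
        answerᵗ j = runᵗ h {A = λ _ v → ⟪ cons (head (tailᵛ (tailᵛ v))) zeros , (λ _ → j) ⟫ (head v)}
          x₀ (⟪⟫ᵗ {B = λ _ _ → j} consᵗ (constᵗ j)) (x₂ ∷ᵗ []ᵗ)
        queryᵗ : Total {3} λ _ v → queryRun (head v) (head (tailᵛ v))
        queryᵗ = runᵗ queryCode {A = λ _ v → cons (head (tailᵛ (tailᵛ v))) zeros (head v)}
          x₀ consᵗ (zeroᵗ ∷ᵗ []ᵗ)

      fixed : ∃ λ i → ∀ {p n m} → p ⊢ searchᶜ majorantᵗ · (i ∷ n ∷ []) ⇓ m → φ[ i , p ] n ⇓ m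
      fixed = recursion (searchᶜ majorantᵗ)

      i* : ℕ
      i* = proj₁ fixed

      -- Termination at every n comes from `halts`, and `answered` ensures that answer j has been
      -- evaluated when the search stops. So the function is everywhere defined and larger than z.
      NMAJ-refuted : ∀ j {s z} → j ≡ 0 ⊎ j ≡ 1 → ⟪ cons i* zeros , (λ _ → j) ⟫ ⊢ h ↦ s → s ≗ z →
                     (∀ n → ∃ λ t → bothAnswered t i* n ≢ 0) →
                     (∀ t n → bothAnswered t i* n ≢ 0 → answerRun j t i* n ≢ 0) →
                     ¬ (NMAJ φ ∋ cons i* zeros ↦ z)
      NMAJ-refuted j {s} {z} bin computed s≗z halts answered (n , ≱) =
        let t , ne          = halts n
            t′ , w , e , d  = search-⇓ majorantᵗ {zeros} {i* ∷ n ∷ []} {t}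
                                λ e → ne (ifz-zero (bothAnswered t i* n) e)
            m , b≡ , w≡     = ifz-suc (bothAnswered t′ i* n) e
            y , a≡          = nonzero (answered t′ n λ b₀ → contradiction (trans (sym b₀) b≡) λ ())
            y≡              = ⇓-deterministic (run-sound h (n ∷ []) a≡) (computed n)
        in <-asym (≱⇒> (proj₂ fixed d) ≱)
             (subst₂ _<_ (trans y≡ (s≗z n)) w≡
               (subst (_≤ answerRun 0 t′ i* n + answerRun 1 t′ i* n) a≡ (summand bin)))
        where
        ifz-zero : ∀ m {x} → ifz m 0 (suc x) ≡ 0 → m ≡ 0
        ifz-zero zero e = refl
        nonzero : ∀ {m} → m ≢ 0 → ∃ λ y → m ≡ suc y
        nonzero {zero}  ne = contradiction refl ne
        nonzero {suc y} ne = y , refl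
        summand : ∀ {j t} → j ≡ 0 ⊎ j ≡ 1 →
                  answerRun j t i* n ≤ answerRun 0 t i* n + answerRun 1 t i* n
        summand (inj₁ refl) = m≤m+n _ _
        summand (inj₂ refl) = m≤n+m _ _

    NMAJ≰DIS : ¬ (NMAJ φ ≤W DIS φ)
    NMAJ≰DIS red =
      let h , k , answers = ≤W-answers {f = NMAJ φ} {g = DIS φ} em DIS-realizer red
          r , Kr , solve  = answers (x h k) (x h k) (λ _ → refl) (NMAJ-total (x h k))
      in refute h k r Kr solve
      where
      x : Code 1 → Code 1 → Baire
      x h k = cons (i* h k) zeros

      module _ (h k : Code 1) (r : Baire) (Kr : x h k ⊢ k ↦ r)
        (solve : ∀ v q y → r ≗ v → q ≗ y → DIS φ ∋ v ↦ y →
                 ∃₂ λ s z → ⟪ x h k , q ⟫ ⊢ h ↦ s × s ≗ z × NMAJ φ ∋ x h k ↦ z) where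

        i = i* h k

        query-computes : ∀ {z} → φ[ r 0 , ⟪ tail (evens r) , odds r ⟫ ] 0 ⇓ z →
                         x h k ⊢ queryCode h k · (0 ∷ []) ⇓ z
        query-computes d = substᶜ-⇓ Kr (⇓comp (⇓∷ (computes (oracleᵗ zeroᵗ) r _) (⇓∷ ⇓proj ⇓[]))
          (substᶜ-⇓ (λ n → computes (⟪⟫ᵗ {0} {λ x v → tail (evens x) (head v)} {λ x v → odds x (head v)}
                                       (evensᵗ (app₁ sucᵗ x₀)) (oddsᵗ x₀)) r (n ∷ [])) d))

        Solution : ℕ → Set
        Solution j = ∃₂ λ s z → ⟪ x h k , (λ _ → j) ⟫ ⊢ h ↦ s × s ≗ z × NMAJ φ ∋ x h k ↦ z

        solution : ∀ j → ¬ (x h k ⊢ queryCode h k · (0 ∷ []) ⇓ j) → Solution j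
        solution j ne = solve r (λ _ → j) (λ _ → j) (λ _ → refl) (λ _ → refl) λ u →
          ne (query-computes (u 0))

        product : ∀ {m n} → m ≢ 0 → n ≢ 0 → m * n ≢ 0
        product {m} a b e = case m*n≡0⇒m≡0∨n≡0 m e of λ where
          (inj₁ z) → a z
          (inj₂ z) → b z

        positive : ∀ {m n} → m ≡ suc n → m ≢ 0
        positive refl ()

        left : ∀ {m n} → m ≢ 0 → m + n ≢ 0
        left {m} ne e = ne (m+n≡0⇒m≡0 m e)

        right : ∀ m {n} → n ≢ 0 → m + n ≢ 0
        right m ne e = ne (m+n≡0⇒n≡0 m e)

        answered : ∀ {j s n} → ⟪ x h k , (λ _ → j) ⟫ ⊢ h ↦ s →
                   Eventually λ t → answerRun h k j t i n ≢ 0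
        answered {n = n} d = eventually-map (λ _ → positive) (run-complete (d n))

        first-factor : ∀ t n → is-zero h k (queryRun h k t i) ≡ 0 →
                       bothAnswered h k t i n ≢ 0 → answerRun h k 0 t i n ≢ 0
        first-factor t n z ne e = ne (cong (_* (answerRun h k 1 t i n + is-positive h k (queryRun h k t i))) (cong₂ _+_ e z))

        second-factor : ∀ t n → is-positive h k (queryRun h k t i) ≡ 0 →
                        bothAnswered h k t i n ≢ 0 → answerRun h k 1 t i n ≢ 0
        second-factor t n z ne e =
          ne (trans (cong ((answerRun h k 0 t i n + is-zero h k (queryRun h k t i)) *_) (cong₂ _+_ e z))
                    (*-zeroʳ (answerRun h k 0 t i n + is-zero h k (queryRun h k t i))))

        query-value : ∀ {z} → x h k ⊢ queryCode h k · (0 ∷ []) ⇓ z → ∀ t →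
                      queryRun h k t i ≡ 0 ⊎ queryRun h k t i ≡ suc z
        query-value {z} d t = go (queryRun h k t i) refl
          where
          go : ∀ m → queryRun h k t i ≡ m → m ≡ 0 ⊎ m ≡ suc z
          go zero    e = inj₁ refl
          go (suc y) e = inj₂ (cong suc (⇓-deterministic (run-sound (queryCode h k) _ e) d))

        undefined : ¬ (∃ λ z → x h k ⊢ queryCode h k · (0 ∷ []) ⇓ z) → ∀ t → queryRun h k t i ≡ 0
        undefined u t = go (queryRun h k t i) refl
          where
          go : ∀ m → queryRun h k t i ≡ m → m ≡ 0
          go zero    e = refl
          go (suc y) e = contradiction (y , run-sound (queryCode h k) _ e) u

        refute : ⊥
        refute = case em {∃ λ z → x h k ⊢ queryCode h k · (0 ∷ []) ⇓ z} of λ where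
          -- U takes the value 0 at 0, so 111... is admissible; the first factor becomes nonzero
          -- through `is-zero`.
          (yes (zero , d)) →
            let s , z , Hs , s≗z , maj = solution 1 λ d′ → contradiction (⇓-deterministic d d′) λ ()
            in NMAJ-refuted h k 1 (inj₂ refl) Hs s≗z
              (λ n → let t , both = eventually-× (answered {n = n} Hs) (run-complete d)
                         a , q≡   = both ≤-refl
                     in t , product (right (answerRun h k 0 t i n)
                                       (positive (cong (is-zero h k) q≡)))
                                    (left a))
              (λ t n → second-factor t n (case query-value d t of λ where
                (inj₁ e) → cong pred e
                (inj₂ e) → cong pred e))
              maj
          (yes (suc b , d)) →
            let s , z , Hs , s≗z , maj = solution 0 λ d′ → contradiction (⇓-deterministic d d′) λ ()
            in NMAJ-refuted h k 0 (inj₁ refl) Hs s≗z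
              (λ n → let t , both = eventually-× (answered {n = n} Hs) (run-complete d)
                         a , q≡   = both ≤-refl
                     in t , product (left a)
                                    (right (answerRun h k 1 t i n) (positive (cong pred q≡))))
              (λ t n → first-factor t n (case query-value d t of λ where
                (inj₁ e) → cong (is-zero h k) e
                (inj₂ e) → cong (is-zero h k) e))
              maj
          -- U is undefined at 0, so both constant answers are admissible and both evaluations halt.
          (no u) →
            let s , z , Hs , s≗z , maj = solution 0 λ d → u (0 , d)
                s′ , _ , Hs′ , _       = solution 1 λ d → u (1 , d)
            in NMAJ-refuted h k 0 (inj₁ refl) Hs s≗z
              (λ n → let t , both = eventually-× (answered {n = n} Hs) (answered {n = n} Hs′)
                         a , b    = both ≤-refl
                     in t , product (left a) (left b))
              (λ t n → first-factor t n (cong (is-zero h k) (undefined u t)))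
              maj

    -- A noncomputable function without hyperimmune functions below it

    -- The condition (e,n) requires that φ_e^f(n) is undefined, and a list of
    -- conditions describes a Π⁰₁ class of binary f.
    violation : List (ℕ × ℕ) → ℕ → Baire → ℕ
    violation []            s f = 0
    violation ((e , n) ∷ L) s f = run universal s f (e ∷ n ∷ []) + violation L s f

    violationᵗ : ∀ {m} L {S : Functional m} {A : Functional (suc m)} → Total S → Total A →
                 Total λ p v → violation L (S p v) (λ x → A p (x ∷ v))
    violationᵗ []            s a = zeroᵗ
    violationᵗ ((e , n) ∷ L) s a =
      app₂ +ᵗ (runᵗ universal s a (constᵗ e ∷ᵗ constᵗ n ∷ᵗ []ᵗ)) (violationᵗ L s a)

    violation-local : ∀ L {s f g} → AgreeBelow s f g → violation L s f ≡ violation L s g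
    violation-local []            h = refl
    violation-local ((e , n) ∷ L) h = cong₂ _+_ (run-local universal h _) (violation-local L h)

    record Member (L : List (ℕ × ℕ)) (f : Baire) : Set where
      constructor _,_
      field
        binary : Binary f
        passes : ∀ s → violation L s f ≡ 0

    member-undefined : ∀ {e n L f z} → Member ((e , n) ∷ L) f → ¬ φ[ e , f ] n ⇓ z
    member-undefined (_ , h) d = let s , halts = run-complete d in
      contradiction (trans (sym (halts ≤-refl)) (m+n≡0⇒m≡0 _ (h s))) λ ()

    member-⊇ : ∀ {c L f} → Member (c ∷ L) f → Member L f
    member-⊇ (bin , h) = bin , λ s → m+n≡0⇒n≡0 _ (h s)

    PassesTo : ℕ → List (ℕ × ℕ) → Baire → Set
    PassesTo n L f = ∀ {s} → s < n → violation L s f ≡ 0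

    -- The search halts relative to every computable f, since f = φ_n has f(n) = φ_n(n).
    diagonalHit : Functional 2
    diagonalHit f v =
      let n = π₁ (head v) in
      ifz (distance (run universal (π₂ (head v)) zeros (n ∷ n ∷ [])) (suc (f n))) 1 0

    diagonalHitᵗ : Total diagonalHit
    diagonalHitᵗ = zero?ᵗ (app₂ distanceᵗ
      (runᵗ universal {A = λ _ _ → 0} (app₁ π₂ᵗ x₀) zeroᵗ (app₁ π₁ᵗ x₀ ∷ᵗ app₁ π₁ᵗ x₀ ∷ᵗ []ᵗ))
      (app₁ sucᵗ (oracleᵗ (app₁ π₁ᵗ x₀))))

    -- The class of binary diagonally noncomputable functions: the search for some n with φ_n(n) =
    -- f(n) must not halt.
    noncomputable : List (ℕ × ℕ)
    noncomputable = (proj₁ (index (searchᶜ diagonalHitᵗ)) , 0) ∷ []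

    noncomputable-≰T : ∀ {f} → Member noncomputable f → ¬ (f ≤T zeros)
    noncomputable-≰T {f} mem (c , h) =
      let n , eq        = index c
          s , halts     = run-complete (Equivalence.from eq (h n))
          _ , _ , _ , d = search-⇓ diagonalHitᵗ {f} {0 ∷ []} {⟨ n , s ⟩}
            (subst₂ (λ n s → ifz (distance (run universal s zeros (n ∷ n ∷ [])) (suc (f n))) 1 0 ≢ 0)
              (sym (π₁-pair n s)) (sym (π₂-pair n s))
              λ e → contradiction (trans (sym e) (cong (λ d → ifz d 1 0)
                (trans (cong (λ m → distance m (suc (f n))) (halts ≤-refl)) (distance-refl (f n))))) λ ())
      in member-undefined mem (Equivalence.from (proj₂ (index (searchᶜ diagonalHitᵗ))) d)

    -- The member takes the value 1 where φ_n(n) = 0 and the value 0 elsewhere, so it differs from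
    -- φ_n(n) throughout.
    noncomputable-nonempty : ∃ (Member noncomputable)
    noncomputable-nonempty = proj₁ ∘ bit , binary , λ s → trans (+-identityʳ _) (unviolated s _ refl)
      where
      bit : ∀ n → ∃ λ b → (φ[ n , zeros ] n ⇓ 0 × b ≡ 1) ⊎ (¬ φ[ n , zeros ] n ⇓ 0 × b ≡ 0)
      bit n = case em {φ[ n , zeros ] n ⇓ 0} of λ where
        (yes d) → 1 , inj₁ (d , refl)
        (no u)  → 0 , inj₂ (u , refl)

      f : Baire
      f = proj₁ ∘ bit

      binary : Binary f
      binary n with bit n
      ... | _ , inj₁ (_ , e) = inj₂ e
      ... | _ , inj₂ (_ , e) = inj₁ e

      avoids : ∀ n → ¬ φ[ n , zeros ] n ⇓ f n
      avoids n d with bit n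
      ... | _ , inj₁ (d′ , refl) = contradiction (⇓-deterministic d d′) λ ()
      ... | _ , inj₂ (u , refl)  = u d

      ifz-nonzero : ∀ d → ifz d 1 0 ≢ 0 → d ≡ 0
      ifz-nonzero zero    ne = refl
      ifz-nonzero (suc d) ne = contradiction refl ne

      unviolated : ∀ s m → run universal s f (proj₁ (index (searchᶜ diagonalHitᵗ)) ∷ 0 ∷ []) ≡ m → m ≡ 0
      unviolated s zero    e = refl
      unviolated s (suc m) e =
        let t , ne = search-nonzero diagonalHitᵗ
              (Equivalence.to (proj₂ (index (searchᶜ diagonalHitᵗ))) (run-sound universal _ e))
        in contradiction
          (run-sound universal _ (distance≡0⇒≡ _ (suc (f (π₁ t))) (ifz-nonzero _ ne)))
          (avoids (π₁ t))

    Stage : Set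
    Stage = ∃ λ L → ∃ (Member L)

    Forcible : ℕ → List (ℕ × ℕ) → Set
    Forcible k L = ∃ λ n → ∃ (Member ((k , n) ∷ L))

    -- The decision is an argument so that later proofs can split on the one that `stage` makes.
    force : ∀ k (S : Stage) → Dec (Forcible k (proj₁ S)) → Stage
    force k (L , _) (yes (n , ne)) = (k , n) ∷ L , ne
    force k S       (no _)         = S

    stage : ℕ → Stage
    stage zero    = noncomputable , noncomputable-nonempty
    stage (suc k) = force k (stage k) em

    class : ℕ → List (ℕ × ℕ)
    class k = proj₁ (stage k)

    class-decreasing : ∀ {j k f} → j ≤′ k → Member (class k) f → Member (class j) f
    class-decreasing ≤′-refl mem = mem
    class-decreasing (≤′-step {k} le) mem = class-decreasing le (weaker (stage k) em mem)
      where
      weaker : ∀ {f} S (D : Dec (Forcible k (proj₁ S))) →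
               Member (proj₁ (force k S D)) f → Member (proj₁ S) f
      weaker S (yes _) mem = member-⊇ mem
      weaker S (no _)  mem = mem

    -- Level n of the compactness argument collects the tests of the classes up to n with bounds
    -- below n; a member of class n passes them since the classes decrease.
    generic : ∃ λ q → ∀ k → Member (class k) q
    generic =
      let q , bin , passes = compactness em (λ n f → ∀ {k s} → k ≤ n → s < n → violation (class k) s f ≡ 0)
            (λ le h k≤ s< → h (≤-trans k≤ le) (≤-trans s< le))
            (λ agree h {k} k≤ s< → trans (sym (violation-local (class k) λ lt → agree (<-trans lt s<)))
                                         (h k≤ s<))
            (λ n → let f , mem = proj₂ (stage n) in f , Member.binary mem ,
              λ {k} {s} k≤ _ → Member.passes (class-decreasing (≤⇒≤′ k≤) mem) s)
      in q , λ k → bin , λ s → passes (k ⊔ suc s) (m≤m⊔n k (suc s)) (m≤n⊔m k (suc s))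

    -- If no condition (k,n) can be added to L, then by compactness some N
    -- bounds the search for a violation along every binary string of length N,
    -- and φ_k^f(n) is bounded by the values found in this finite search.
    module _ (k : ℕ) (L : List (ℕ × ℕ)) (unforcible : ¬ Forcible k L) where

      allViolated : ℕ → ℕ → ℕ
      allViolated N n = productBelow (pow2 N) λ w → sumBelow N λ s → violation ((k , n) ∷ L) s (bits w)

      values : ℕ → ℕ → ℕ
      values N n = sumBelow (pow2 N) λ w → sumBelow N λ s → run universal s (bits w) (k ∷ n ∷ [])

      fanBound : Functional 2
      fanBound _ v = ifz (allViolated (head v) (head (tailᵛ v))) 0 (suc (values (head v) (head (tailᵛ v))))

      fanBoundᵗ : Total fanBound
      fanBoundᵗ = app₃ ifzᵗ
        (productBelowᵗ (app₁ pow2ᵗ x₀) (sumBelowᵗ x₁ (app₂ +ᵗ runᵗ′ (violationᵗ L x₀ bitsᵗ′))))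
        zeroᵗ
        (app₁ sucᵗ (sumBelowᵗ (app₁ pow2ᵗ x₀) (sumBelowᵗ x₁ runᵗ′)))
        where
        bitsᵗ′ : Total {5} λ _ v → bits (head (tailᵛ (tailᵛ v))) (head v)
        bitsᵗ′ = bitsᵗ x₂ x₀
        runᵗ′ : Total {4} λ _ v → run universal (head v) (bits (head (tailᵛ v)))
                                      (k ∷ head (tailᵛ (tailᵛ (tailᵛ v))) ∷ [])
        runᵗ′ = runᵗ universal {A = λ _ v → bits (head (tailᵛ (tailᵛ v))) (head v)} x₀ bitsᵗ′
                     (constᵗ k ∷ᵗ headᵗ (tailᵗ (tailᵗ (tailᵗ idᵗ))) ∷ᵗ []ᵗ)

      -- Compactness in contrapositive form: if for every N some binary f had no violation below N,
      -- a single f would have none at all, and (k,n) could be added to L.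
      uniformly-violated : ∀ n → ∃ λ N → ∀ f → Binary f → ∃ λ s → s < N × violation ((k , n) ∷ L) s f ≢ 0
      uniformly-violated n =
        let N , none = counterexample em {P = λ N → ∃ λ f → Binary f × PassesTo N ((k , n) ∷ L) f} λ h →
              let f , bin , passes = compactness em (λ N f → PassesTo N ((k , n) ∷ L) f)
                    (λ le h lt → h (≤-trans lt le))
                    (λ agree h lt → trans (sym (violation-local ((k , n) ∷ L) λ lt′ → agree (<-trans lt′ lt)))
                                          (h lt))
                    h
              in unforcible (n , f , bin , λ s → passes (suc s) ≤-refl)
        in N , λ f bin → decidable-stable em λ none′ → none (f , bin , λ {s} lt →
             decidable-stable em λ ne → none′ (s , lt , ne))

      majorant-at : ∀ n → ∃₂ λ N z → fanBound zeros (N ∷ n ∷ []) ≡ suc z ×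
                                     zeros ⊢ searchᶜ fanBoundᵗ · (n ∷ []) ⇓ z
      majorant-at n = let N , violated = uniformly-violated n in
        search-⇓ fanBoundᵗ {zeros} {n ∷ []} {N} λ e →
          productBelow-nonzero (pow2 N) (λ w → sumBelow N λ s → violation ((k , n) ∷ L) s (bits w))
            (λ {w} _ e → let s , lt , ne = violated (bits w) (bits-binary w) in
              ne (n≤0⇒n≡0 (subst (violation ((k , n) ∷ L) s (bits w) ≤_) e
                            (≤-sumBelow N (λ s → violation ((k , n) ∷ L) s (bits w)) lt))))
            (ifz-zero (allViolated N n) e)
        where
        ifz-zero : ∀ m {x} → ifz m 0 (suc x) ≡ 0 → m ≡ 0
        ifz-zero zero e = refl

      majorant-bounds : ∀ {f} {y : Baire} → Member L f → (∀ n → φ[ k , f ] n ⇓ y n) →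
                        ∃ λ r → r ≤T zeros × ∀ n → y n ≤ r n
      majorant-bounds {f} {y} (bin , passes) h =
        (λ n → proj₁ (proj₂ (majorant-at n))) ,
        (searchᶜ fanBoundᵗ , λ n → proj₂ (proj₂ (proj₂ (majorant-at n)))) , bound
        where
        result : ℕ → ℕ → ℕ → ℕ
        result N n w = sumBelow N λ s → run universal s (bits w) (k ∷ n ∷ [])

        violated : ∀ N n → allViolated N n ≢ 0 →
                   ∃ λ s → s < N × violation ((k , n) ∷ L) s (bits (encode N f)) ≢ 0
        violated N n ne = sumBelow-nonzero N (λ s → violation ((k , n) ∷ L) s (bits (encode N f)))
          (productBelow-factor (pow2 N)
            (λ w → sumBelow N λ s → violation ((k , n) ∷ L) s (bits w)) ne (encode-< N bin))

        -- Since f passes L and the string agrees with f below s, the violation can only come from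
        -- the new condition (k,n), that is, from a halting evaluation.
        evaluated : ∀ N n {s} → s < N → violation ((k , n) ∷ L) s (bits (encode N f)) ≢ 0 →
                    run universal s (bits (encode N f)) (k ∷ n ∷ []) ≡ suc (y n)
        evaluated N n {s} lt ne = value _ refl
          where
          agree : AgreeBelow s (bits (encode N f)) f
          agree lt′ = bits-encode N bin (<-trans lt′ lt)
          value : ∀ m → run universal s (bits (encode N f)) (k ∷ n ∷ []) ≡ m → m ≡ suc (y n)
          value zero    e = contradiction (cong₂ _+_ e (trans (violation-local L agree) (passes s))) ne
          value (suc b) e = cong suc (⇓-deterministic
            (run-sound universal (k ∷ n ∷ []) (trans (sym (run-local universal agree (k ∷ n ∷ []))) e)) (h n))

        bounded : ∀ N n {z m} → allViolated N n ≡ suc m → values N n ≡ z → y n ≤ z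
        bounded N n {z} product≡ refl 
          with violated N n (λ e → contradiction (trans (sym product≡) e) λ ())
        ... | s , lt , ne = begin
          y n                      ≤⟨ n≤1+n (y n) ⟩
          suc (y n)                ≡⟨ evaluated N n lt ne ⟨
          run universal s (bits (encode N f)) (k ∷ n ∷ [])
                                   ≤⟨ ≤-sumBelow N (λ s → run universal s (bits (encode N f)) (k ∷ n ∷ [])) lt ⟩
          result N n (encode N f)  ≤⟨ ≤-sumBelow (pow2 N) (result N n) (encode-< N bin) ⟩
          values N n               ∎
          where open ≤-Reasoning

        bound : ∀ n → y n ≤ proj₁ (proj₂ (majorant-at n))
        bound n = at (majorant-at n)
          where
          at : (m : ∃₂ λ N z → fanBound zeros (N ∷ n ∷ []) ≡ suc z ×
                               zeros ⊢ searchᶜ fanBoundᵗ · (n ∷ []) ⇓ z) → y n ≤ proj₁ (proj₂ m)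
          at (N , z , found , _) =
            let m , product≡ , z≡ = ifz-suc (allViolated N n) found in bounded N n {z} {m} product≡ z≡

    -- Let k be an index of y relative to q. If stage k forced some (k,n), then y(n) would be
    -- undefined; otherwise a computable function majorizes y.
    generic-hyperimmune-free : ∀ {y} → y ≤T proj₁ generic → ¬ (HYP ∋ zeros ↦ y)
    generic-hyperimmune-free {y} (c , h) hyp = cases em refl
      where
      q = proj₁ generic
      k = proj₁ (index c)
      k-φ : ∀ n → φ[ k , q ] n ⇓ y n
      k-φ n = Equivalence.from (proj₂ (index c)) (h n)

      cases : ∀ D → force k (stage k) D ≡ stage (suc k) → ⊥
      cases (yes (n , _)) e = member-undefined
        (subst (λ S → Member (proj₁ S) q) (sym e) (proj₂ generic (suc k))) (k-φ n)
      cases (no unforcible) e =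
        let r , le , bound = majorant-bounds k (class k) unforcible {q} {y} (proj₂ generic k) k-φ
            n , lt         = hyp r le
        in <⇒≱ lt (bound n)

    HYP^𝒟≰NON : ¬ (HYP ^𝒟 ≤W NON)
    HYP^𝒟≰NON red =
      let h , k , answers = ≤W-answers {f = HYP ^𝒟} {g = NON} em NON-realizer red
          q , member      = generic
          r , Kr , solve  = answers zeros zeros (λ _ → refl) (HYP^𝒟-total zeros)
          s , d , Hs , s≡d , q′ , d≡q′ , y , (y′ , y′≗y , y′≤q′) , hyp =
            -- The query r is computable and q is not, so q is an admissible answer.
            solve r q q (λ _ → refl) (λ _ → refl) λ q≤r →
              noncomputable-≰T (member 0) (≤T-trans q≤r (k , Kr))
      in generic-hyperimmune-free
           (≤T-trans (≤T-reflexive (sym ∘ y′≗y)) (≤T-trans y′≤q′ (≤T-trans (proj₂ d≡q′)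
             (≤T-trans (proj₂ s≡d) (≤T-trans (h , Hs)
               (⟪⟫-≤T (≤T-total zeroᵗ q) (≤T-reflexive λ _ → refl)))))))
           hyp

proposition6p3 : ExcludedMiddle 0ℓ →
    (φ : GödelNumbering) →
    ((Σᵂ (NMAJ φ) ≡W Σᵂ (NGEQ φ)) × (Σᵂ (NGEQ φ) ≡W DIS φ)) ×
    (Πᵂ (NMAJ φ) ≡sW HYP) ×
    ((DIS φ <W NMAJ φ) × (NMAJ φ <W HYP)) ×
    (NON <W HYP ^𝒟) ×
    (¬ (NMAJ φ ≡W Σᵂ (NMAJ φ)))
proposition6p3 em φ =
  ((ΣNMAJ≤ΣNGEQ , ≤W-trans {f = ΣNGEQ} {DIS φ} {ΣNMAJ} ΣNGEQ≤DIS DIS≤ΣNMAJ) ,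
   (ΣNGEQ≤DIS , ≤W-trans {f = DIS φ} {ΣNMAJ} {ΣNGEQ} DIS≤ΣNMAJ ΣNMAJ≤ΣNGEQ)) ,
  (ΠNMAJ≤HYP , HYP≤ΠNMAJ) ,
  ((≤W-trans {f = DIS φ} {ΣNMAJ} {NMAJ φ} DIS≤ΣNMAJ ΣNMAJ≤NMAJ , NMAJ≰DIS) ,
   (NMAJ≤HYP , HYP≰NMAJ)) ,
  (NON≤HYP^𝒟 , HYP^𝒟≰NON) ,
  λ (NMAJ≤ΣNMAJ , _) → NMAJ≰DIS
    (≤W-trans {f = NMAJ φ} {ΣNMAJ} {DIS φ} NMAJ≤ΣNMAJ
      (≤W-trans {f = ΣNMAJ} {ΣNGEQ} {DIS φ} ΣNMAJ≤ΣNGEQ ΣNGEQ≤DIS))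
  where
  open Gödel φ
  open Classical em
  ΣNMAJ = Σᵂ (NMAJ φ)
  ΣNGEQ = Σᵂ (NGEQ φ)
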